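{- (i) Let $p$ be a prime with $p\equiv 3\pmod 4$, and let $r$ be an integer with $1\leq r<4p$, $\gcd(r,p)=1$, and $rp\equiv 1\pmod 4$. Then for all integers $\alpha\geq 0$ and $n\geq 0$, $$ped_{ -2}\left(p^{2\alpha+2}n+\frac{r\,p^{2\alpha+1}-1}{4}\right)\equiv 0\pmod 8.$$ (ii) Let $p$ be a prime with $p\equiv 1\pmod 4$, and let $r$ be an integer with $1\leq r<4p$, $\gcd(r,p)=1$, and $rp\equiv 1\pmod 4$. Then for all integers $\alpha\geq 0$ and $n\geq 0$, $$ped_{ -2}\left(p^{8\alpha+8}n+\frac{r\,p^{8\alpha+7}-1}{4}\right)\equiv 0\pmod 8.$$
   Context: For an integer $n\ge 0$, $ped_{ -2}(n)$ denotes the number of bipartitions of $n$ with even parts distinct, i.e. the number of ordered pairs of partitions $(\lambda,\mu)$ with total size $|\lambda|+|\mu|=n$ such that in each of $\lambda$ and $\mu$ the even parts are distinct (odd parts are unrestricted). Its generating function is $$\sum_{n=0}^{\infty}ped_{ -2}(n)q^n=\prod_{m=1}^{\infty}\frac{(1-q^{4m})^2}{(1-q^m)^2}.$$ -}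

module Defs where

open import Data.List.Base
  using (List; []; _∷_; concatMap; cartesianProduct; filter; length; upTo)
open import Data.List.Membership.Propositional using (_∈_; find; lose)
open import Data.List.Membership.Propositional.Properties
  using (∈-concatMap⁺; ∈-concatMap⁻; ∈-cartesianProduct⁺; ∈-cartesianProduct⁻;
         ∈-filter⁺; ∈-filter⁻; ∈-upTo⁺; ∈-upTo⁻)
open import Data.List.Relation.Binary.Disjoint.Propositional using (Disjoint)
open import Data.List.Relation.Unary.All as All using (All; []; _∷_; all?)
open import Data.List.Relation.Unary.AllPairs using ([]; _∷_)
open import Data.List.Relation.Unary.Any using (here; there)
open import Data.List.Relation.Unary.Linked using (Linked; linked?)
open import Data.List.Relation.Unary.Unique.Propositional using (Unique)
import Data.List.Relation.Unary.Unique.Propositional.Properties as Unique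
open import Data.Nat.Base using (ℕ; zero; suc; _+_; _∸_; _<_; _≥_; z≤n; s≤s)
open import Data.Nat.Divisibility using (_∣_; _∣?_)
open import Data.Nat.ListAction using (sum)
open import Data.Nat.Properties
  using (_≟_; _<?_; _≥?_; suc-injective; m≤m+n; m+n∸m≡n; m+[n∸m]≡n; ≤-pred)
open import Data.List.Relation.Unary.Unique.DecPropositional _≟_ using (unique?)
open import Data.Product.Base using (_×_; _,_; proj₁; proj₂)
open import Function.Bundles using (_⇔_; mk⇔; module Equivalence)
open import Relation.Binary.PropositionalEquality
  using (_≡_; _≢_; refl; sym; trans; cong; cong₂)
open import Relation.Nullary using (Dec)
open import Relation.Nullary.Decidable using (_×-dec_)

-- A partition is the list of its parts in weakly decreasing order; its size
-- is `sum`.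
IsPartition : List ℕ → Set
IsPartition xs = Linked _≥_ xs × All (0 <_) xs

EvenPartsDistinct : List ℕ → Set
EvenPartsDistinct xs = Unique (filter (2 ∣?_) xs)

IsPedPartition : List ℕ → Set
IsPedPartition xs = IsPartition xs × EvenPartsDistinct xs

IsPedBipartition : ℕ → List ℕ × List ℕ → Set
IsPedBipartition n (xs , ys) =
  IsPedPartition xs × IsPedPartition ys × sum xs + sum ys ≡ n

isPedPartition? : ∀ xs → Dec (IsPedPartition xs)
isPedPartition? xs =
  (linked? _≥?_ xs ×-dec all? (0 <?_) xs) ×-dec unique? (filter (2 ∣?_) xs)

-- A composition of suc n either starts with 1, followed by a composition of
-- n, or is a nonempty composition of n with its first part increased by one.
extend : List ℕ → List (List ℕ)
extend []       = (1 ∷ []) ∷ []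
extend (x ∷ xs) = (1 ∷ x ∷ xs) ∷ (suc x ∷ xs) ∷ []

compositions : ℕ → List (List ℕ)
compositions zero    = [] ∷ []
compositions (suc n) = concatMap extend (compositions n)

pedPartitions : ℕ → List (List ℕ)
pedPartitions n = filter isPedPartition? (compositions n)

pedBipartitionsAt : ℕ → ℕ → List (List ℕ × List ℕ)
pedBipartitionsAt n i = cartesianProduct (pedPartitions i) (pedPartitions (n ∸ i))

pedBipartitions : ℕ → List (List ℕ × List ℕ)
pedBipartitions n = concatMap (pedBipartitionsAt n) (upTo (suc n))

-- That this list has every bipartition of n with even parts distinct exactly
-- once is `∈-pedBipartitions` together with `pedBipartitions-unique`.
ped₋₂ : ℕ → ℕ
ped₋₂ n = length (pedBipartitions n)

private

  unique-concatMap : ∀ {A B : Set} (f : A → List B) (xs : List A) →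
    (∀ x → x ∈ xs → Unique (f x)) →
    (∀ x y → x ∈ xs → y ∈ xs → x ≢ y → Disjoint (f x) (f y)) →
    Unique xs → Unique (concatMap f xs)
  unique-concatMap f []       u d []         = []
  unique-concatMap f (x ∷ xs) u d (x∉ ∷ xs!) =
    Unique.++⁺ (u x (here refl))
      (unique-concatMap f xs (λ y y∈ → u y (there y∈))
        (λ y z y∈ z∈ → d y z (there y∈) (there z∈)) xs!)
      λ { (v∈fx , v∈rest) →
          let y , y∈xs , v∈fy = find (∈-concatMap⁻ f {xs = xs} v∈rest)
          in d x y (here refl) (there y∈xs) (All.lookup x∉ y∈xs) (v∈fx , v∈fy) }

  compositions-sum : ∀ n {xs} → xs ∈ compositions n → sum xs ≡ n
  compositions-sum zero (here refl) = refl
  compositions-sum (suc n) p with find (∈-concatMap⁻ extend {xs = compositions n} p)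
  ... | []     , q , here refl         = cong suc (compositions-sum n q)
  ... | y ∷ ys , q , here refl         = cong suc (compositions-sum n q)
  ... | y ∷ ys , q , there (here refl) = cong suc (compositions-sum n q)

  compositions-pos : ∀ n {xs} → xs ∈ compositions n → All (0 <_) xs
  compositions-pos zero (here refl) = []
  compositions-pos (suc n) p with find (∈-concatMap⁻ extend {xs = compositions n} p)
  ... | []     , q , here refl         = s≤s z≤n ∷ []
  ... | y ∷ ys , q , here refl         = s≤s z≤n ∷ compositions-pos n q
  ... | y ∷ ys , q , there (here refl) with compositions-pos n q
  ...   | _ ∷ ys>0 = s≤s z≤n ∷ ys>0

  compositions-complete : ∀ n xs → All (0 <_) xs → sum xs ≡ n → xs ∈ compositions n
  compositions-complete zero    []               _        _ = here refl
  compositions-complete zero    (suc _ ∷ _)      _        ()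
  compositions-complete n       (zero ∷ _)       (() ∷ _) _
  compositions-complete (suc n) (1 ∷ [])         (_ ∷ ps) e =
    ∈-concatMap⁺ extend (lose (compositions-complete n [] [] (suc-injective e)) (here refl))
  compositions-complete (suc n) (1 ∷ x ∷ xs)     (_ ∷ ps) e =
    ∈-concatMap⁺ extend (lose (compositions-complete n (x ∷ xs) ps (suc-injective e)) (here refl))
  compositions-complete (suc n) (suc (suc x) ∷ xs) (_ ∷ ps) e =
    ∈-concatMap⁺ extend
      (lose (compositions-complete n (suc x ∷ xs) (s≤s z≤n ∷ ps) (suc-injective e))
            (there (here refl)))

  extend-unique : ∀ xs → All (0 <_) xs → Unique (extend xs)
  extend-unique []           _ = [] ∷ []
  extend-unique (zero ∷ _)   (() ∷ _)
  extend-unique (suc x ∷ xs) _ = ((λ ()) ∷ []) ∷ [] ∷ []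

  extend-injective : ∀ {xs ys v} → All (0 <_) xs → All (0 <_) ys →
    v ∈ extend xs → v ∈ extend ys → xs ≡ ys
  extend-injective {[]}    {[]}    _ _ _ _ = refl
  extend-injective {[]}    {_ ∷ _} _ (() ∷ _) (here refl) (there (here refl))
  extend-injective {_ ∷ _} {[]}    (() ∷ _) _ (there (here refl)) (here refl)
  extend-injective {_ ∷ _} {_ ∷ _} _ _ (here refl) (here refl) = refl
  extend-injective {_ ∷ _} {_ ∷ _} _ (() ∷ _) (here refl) (there (here refl))
  extend-injective {_ ∷ _} {_ ∷ _} (() ∷ _) _ (there (here refl)) (here refl)
  extend-injective {_ ∷ _} {_ ∷ _} _ _ (there (here refl)) (there (here refl)) = refl

  compositions-unique : ∀ n → Unique (compositions n)
  compositions-unique zero    = [] ∷ []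
  compositions-unique (suc n) =
    unique-concatMap extend (compositions n)
      (λ xs xs∈ → extend-unique xs (compositions-pos n xs∈))
      (λ xs ys xs∈ ys∈ xs≢ys (p , q) →
        xs≢ys (extend-injective (compositions-pos n xs∈) (compositions-pos n ys∈) p q))
      (compositions-unique n)

∈-pedPartitions : ∀ n xs → xs ∈ pedPartitions n ⇔ (IsPedPartition xs × sum xs ≡ n)
∈-pedPartitions n xs = mk⇔
  (λ xs∈ → let q , ped = ∈-filter⁻ isPedPartition? {xs = compositions n} xs∈
           in ped , compositions-sum n q)
  (λ { (ped@((_ , xs>0) , _) , e) →
       ∈-filter⁺ isPedPartition? (compositions-complete n xs xs>0 e) ped })

pedPartitions-unique : ∀ n → Unique (pedPartitions n)
pedPartitions-unique n = Unique.filter⁺ isPedPartition? (compositions-unique n)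

private

  ∈-pedBipartitionsAt⁻ : ∀ n i {xs ys} → (xs , ys) ∈ pedBipartitionsAt n i →
    (IsPedPartition xs × sum xs ≡ i) × (IsPedPartition ys × sum ys ≡ n ∸ i)
  ∈-pedBipartitionsAt⁻ n i {xs} {ys} p =
    let xs∈ , ys∈ = ∈-cartesianProduct⁻ (pedPartitions i) (pedPartitions (n ∸ i)) p
    in Equivalence.to (∈-pedPartitions i xs) xs∈ , Equivalence.to (∈-pedPartitions (n ∸ i) ys) ys∈

∈-pedBipartitions : ∀ n b → b ∈ pedBipartitions n ⇔ IsPedBipartition n b
∈-pedBipartitions n (xs , ys) = mk⇔ sound complete
  where
  sound : (xs , ys) ∈ pedBipartitions n → IsPedBipartition n (xs , ys)
  sound p =
    let i , i∈ , q = find (∈-concatMap⁻ (pedBipartitionsAt n) {xs = upTo (suc n)} p)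
        (xs-ped , xs-sum) , (ys-ped , ys-sum) = ∈-pedBipartitionsAt⁻ n i q
    in xs-ped , ys-ped ,
       trans (cong₂ _+_ xs-sum ys-sum) (m+[n∸m]≡n (≤-pred (∈-upTo⁻ i∈)))

  complete : IsPedBipartition n (xs , ys) → (xs , ys) ∈ pedBipartitions n
  complete (xs-ped , ys-ped , refl) =
    ∈-concatMap⁺ (pedBipartitionsAt n)
      (lose (∈-upTo⁺ (s≤s (m≤m+n (sum xs) (sum ys))))
        (∈-cartesianProduct⁺
          (Equivalence.from (∈-pedPartitions (sum xs) xs) (xs-ped , refl))
          (Equivalence.from (∈-pedPartitions (n ∸ sum xs) ys)
            (ys-ped , sym (m+n∸m≡n (sum xs) (sum ys))))))

pedBipartitions-unique : ∀ n → Unique (pedBipartitions n)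
pedBipartitions-unique n =
  unique-concatMap (pedBipartitionsAt n) (upTo (suc n))
    (λ i _ → Unique.cartesianProduct⁺ (pedPartitions-unique i) (pedPartitions-unique (n ∸ i)))
    (λ i j _ _ i≢j (p , q) →
      i≢j (trans (sym (proj₂ (proj₁ (∈-pedBipartitionsAt⁻ n i p))))
                 (proj₂ (proj₁ (∈-pedBipartitionsAt⁻ n j q)))))
    (Unique.upTo⁺ (suc n))

{-# OPTIONS --safe #-}
module Submission where

-- Write ψ(q) = ∑ q^(k(k+1)/2) = ∏ (1−q^2k)/(1−q^(2k−1)) and let φ(−q) = 1 + 2S(q) be
-- ∏ (1−q^k)/(1+q^k).  The partitions with distinct even parts are generated by
-- P = ψ(q)/φ(−q²), so that P² ≡ ψ(q)² + 4ψ(q)²(S(q²) + S(q²)²) modulo 8, while S(q)² ≡ S(q²)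
-- modulo 2.  Comparing products gives φ(−q)ψ(q) = ψ(−q)φ(−q²), hence
-- ψ(q)(S(q) + S(q²)) ≡ (ψ(−q) − ψ(q))/2 modulo 2, and squaring shows that the second summand
-- contributes 4 times a series supported on those m for which 4m+1 is a square.
-- The coefficient of q^m in ψ(q)² is ∑ χ(d) over the divisors d of 4m+1, where χ is the
-- nontrivial character modulo 4, because
-- ψ(q)² = ∑ (−1)^k q^(k²+k) (1+q^(2k+1))/(1−q^(2k+1)).
-- For 4m+1 = p^e M with p ∤ M this sum is ∑ χ(p)^i over i ≤ e, times the sum for M.

open import Data.Integer.Base using (ℤ; +_; 0ℤ; 1ℤ; -1ℤ)
import Data.Integer.Base as Z hiding (+_)
import Data.Integer.Properties as ℤₚ
import Data.Integer.Solver as ℤSolver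
open import Data.Nat.Base as ℕ using (ℕ; zero; suc; _≤_; _<_; z≤n; s≤s; NonZero)
open import Data.Nat.Divisibility
import Data.Nat.Properties as ℕₚ
import Data.Nat.Solver as ℕSolver
open import Data.Product.Base using (_×_; _,_; proj₁; proj₂; ∃)
open import Relation.Binary.PropositionalEquality as ≡ using (_≡_; _≢_; cong; cong₂)
open import Relation.Nullary using (Dec; yes; no; ¬_; contradiction)

-- No infinite product or limit occurs. The product identities are proved for finite products,
-- exactly or modulo a power of q, and the coefficient of index m is read off from truncations at m
-- + 1. The square of ψ is the hard part: its Lambert series needs a finite version whose error is a
-- high power of q, and this comes from a partial fraction expansion whose terms obey a recurrence
-- in the number of factors. The halving in (ψ(-q) - ψ(q))/2 shapes the notion of congruence: an
-- integer modulus and a series modulus are kept apart, so that an identity can be carried modulo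
-- X^n alone, divided by 2, and only then reduced modulo 2. That p divides 4m+1 to an odd power e
-- has three effects. 4m+1 is not a square, so the second summand vanishes. The pairing of d with
-- (4m+1)/d has no fixed point, so the Lambert coefficient, which counts each d below the square
-- root twice, is the whole divisor sum. The powers of p from 0 to e are even in number, so their
-- characters cancel when p ≡ 3. When p ≡ 1 they contribute e + 1, and e = 8α + 7 makes this a
-- multiple of 8.

module FormalSeries where

  open import Algebra.Bundles using (CommutativeRing)
  open import Algebra.Structures using (IsCommutativeRing)
  open import Algebra.Solver.Ring.AlmostCommutativeRing
    using (AlmostCommutativeRing; fromCommutativeRing; _-Raw-AlmostCommutative⟶_)
  import Algebra.Solver.Ring
  open import Data.Maybe.Base using (Maybe; just; nothing)
  open import Level using (0ℓ)

  -- The ring of formal power series with integer coefficients.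

  Series : Set
  Series = ℕ → ℤ

  infix 4 _≈_
  -- A record and not a bare pointwise equality, so that both series can be inferred from the type
  -- of a proof.
  record _≈_ (f g : Series) : Set where
    constructor coeffwise
    field at : ∀ n → f n ≡ g n
  open _≈_ public

  tail : Series → Series
  tail f n = f (suc n)

  const : ℤ → Series
  const c zero    = c
  const c (suc n) = 0ℤ

  -- The Cauchy product, by peeling off the constant term of `f`; `length-concatMap-conv` consumes a
  -- list of pairs in the same order.
  conv : Series → Series → Series
  conv f g zero    = f 0 Z.* g 0
  conv f g (suc n) = f 0 Z.* g (suc n) Z.+ conv (tail f) g n

  module ConvolutionLaws where
    open ≡.≡-Reasoning
    open ℤSolver.+-*-Solver

    conv-cong : ∀ {f f′ g g′} → (∀ n → f n ≡ f′ n) → (∀ n → g n ≡ g′ n) →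
      ∀ n → conv f g n ≡ conv f′ g′ n
    conv-cong p r zero    = cong₂ Z._*_ (p 0) (r 0)
    conv-cong p r (suc n) =
      cong₂ Z._+_ (cong₂ Z._*_ (p 0) (r (suc n))) (conv-cong (λ m → p (suc m)) r n)

    conv-last : ∀ f g n → conv f g (suc n) ≡ f (suc n) Z.* g 0 Z.+ conv f (tail g) n
    conv-last f g zero    = ℤₚ.+-comm (f 0 Z.* g 1) _
    conv-last f g (suc n) = begin
      a Z.+ conv (tail f) g (suc n)          ≡⟨ cong (Z._+_ a) (conv-last (tail f) g n) ⟩
      a Z.+ (b Z.+ conv (tail f) (tail g) n)
        ≡⟨ solve 3 (λ x y z → x :+ (y :+ z) := y :+ (x :+ z)) ≡.refl a b _ ⟩
      b Z.+ (a Z.+ conv (tail f) (tail g) n) ∎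
      where
      a = f 0 Z.* g (suc (suc n))
      b = f (suc (suc n)) Z.* g 0

    conv-comm : ∀ f g n → conv f g n ≡ conv g f n
    conv-comm f g zero    = ℤₚ.*-comm (f 0) (g 0)
    conv-comm f g (suc n) = begin
      f 0 Z.* g (suc n) Z.+ conv (tail f) g n
        ≡⟨ cong₂ Z._+_ (ℤₚ.*-comm (f 0) _) (conv-comm (tail f) g n) ⟩
      g (suc n) Z.* f 0 Z.+ conv g (tail f) n ≡⟨ conv-last g f n ⟨
      conv g f (suc n)                        ∎

    conv-distribʳ : ∀ h f g n → conv (λ m → f m Z.+ g m) h n ≡ conv f h n Z.+ conv g h n
    conv-distribʳ h f g zero    = ℤₚ.*-distribʳ-+ (h 0) (f 0) (g 0)
    conv-distribʳ h f g (suc n) rewrite conv-distribʳ h (tail f) (tail g) n =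
      solve 5 (λ a b c x y → (a :+ b) :* c :+ (x :+ y) := (a :* c :+ x) :+ (b :* c :+ y)) ≡.refl
        (f 0) (g 0) (h (suc n)) _ _

    conv-scale : ∀ c f g n → conv (λ m → c Z.* f m) g n ≡ c Z.* conv f g n
    conv-scale c f g zero    = ℤₚ.*-assoc c (f 0) (g 0)
    conv-scale c f g (suc n) rewrite conv-scale c (tail f) g n =
      solve 4 (λ c a b x → c :* a :* b :+ c :* x := c :* (a :* b :+ x)) ≡.refl c (f 0) (g (suc n)) _

    conv-assoc : ∀ f g h n → conv (conv f g) h n ≡ conv f (conv g h) n
    conv-assoc f g h zero    = ℤₚ.*-assoc (f 0) (g 0) (h 0)
    conv-assoc f g h (suc n) = begin
      f 0 Z.* g 0 Z.* h (suc n) Z.+ conv (λ m → f 0 Z.* g (suc m) Z.+ conv (tail f) g m) h n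
        ≡⟨ cong (Z._+_ (f 0 Z.* g 0 Z.* h (suc n))) (conv-distribʳ h _ _ n) ⟩
      f 0 Z.* g 0 Z.* h (suc n) Z.+
        (conv (λ m → f 0 Z.* tail g m) h n Z.+ conv (conv (tail f) g) h n)
        ≡⟨ cong₂ (λ x y → f 0 Z.* g 0 Z.* h (suc n) Z.+ (x Z.+ y))
             (conv-scale (f 0) (tail g) h n) (conv-assoc (tail f) g h n) ⟩
      f 0 Z.* g 0 Z.* h (suc n) Z.+
        (f 0 Z.* conv (tail g) h n Z.+ conv (tail f) (conv g h) n)
        ≡⟨ solve 5 (λ a b c x y → a :* b :* c :+ (a :* x :+ y) := a :* (b :* c :+ x) :+ y) ≡.refl
             (f 0) (g 0) (h (suc n)) _ _ ⟩
      f 0 Z.* conv g h (suc n) Z.+ conv (tail f) (conv g h) n ∎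

    conv-const : ∀ c f n → conv (const c) f n ≡ c Z.* f n
    conv-const c f zero    = ≡.refl
    conv-const c f (suc n) = ≡.trans (cong (Z._+_ (c Z.* f (suc n))) (conv-zero n))
      (ℤₚ.+-identityʳ _)
      where
      conv-zero : ∀ n → conv (tail (const c)) f n ≡ 0ℤ
      conv-zero zero    = ≡.refl
      conv-zero (suc n) rewrite conv-zero n = ≡.refl

  open ConvolutionLaws

  infixl 7 _*_
  infixl 6 _+_
  infix  8 -_

  opaque
    -- Opaque, so that the ring solver and unification treat the operations as symbols; the `-at`
    -- lemmas are the way back to coefficients.
    _+_ : Series → Series → Series
    (f + g) n = f n Z.+ g n

    _*_ : Series → Series → Series
    _*_ = conv

    -_ : Series → Series
    (- f) n = Z.- f n

    +-at : ∀ f g n → (f + g) n ≡ f n Z.+ g n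
    +-at f g n = ≡.refl

    *-at : ∀ f g n → (f * g) n ≡ conv f g n
    *-at f g n = ≡.refl

    -‿at : ∀ f n → (- f) n ≡ Z.- f n
    -‿at f n = ≡.refl

  0# 1# : Series
  0# = const 0ℤ
  1# = const 1ℤ

  opaque
    unfolding _+_

    0-at : ∀ n → 0# n ≡ 0ℤ
    0-at zero    = ≡.refl
    0-at (suc n) = ≡.refl

    isCommutativeRing : IsCommutativeRing _≈_ _+_ _*_ -_ 0# 1#
    isCommutativeRing = record
      { isRing = record
        { +-isAbelianGroup = record
          { isGroup = record
            { isMonoid = record
              { isSemigroup = record
                { isMagma = record
                  { isEquivalence = record
                    { refl  = coeffwise λ n → ≡.refl
                    ; sym   = λ p → coeffwise λ n → ≡.sym (at p n)
                    ; trans = λ p r → coeffwise λ n → ≡.trans (at p n) (at r n)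
                    }
                  ; ∙-cong = λ p r → coeffwise λ n → cong₂ Z._+_ (at p n) (at r n)
                  }
                ; assoc = λ f g h → coeffwise λ n → ℤₚ.+-assoc (f n) (g n) (h n)
                }
              ; identity = (λ f → coeffwise λ n → ≡.trans (cong (Z._+ f n) (0-at n))
                (ℤₚ.+-identityˡ _))
                         , (λ f → coeffwise λ n → ≡.trans (cong (λ z → f n Z.+ z) (0-at n))
                           (ℤₚ.+-identityʳ _))
              }
            ; inverse = (λ f → coeffwise λ n → ≡.trans (ℤₚ.+-inverseˡ (f n)) (≡.sym (0-at n)))
                      , (λ f → coeffwise λ n → ≡.trans (ℤₚ.+-inverseʳ (f n)) (≡.sym (0-at n)))
            ; ⁻¹-cong = λ p → coeffwise λ n → cong Z.-_ (at p n)
            }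
          ; comm = λ f g → coeffwise λ n → ℤₚ.+-comm (f n) (g n)
          }
        ; *-cong = λ p r → coeffwise (conv-cong (at p) (at r))
        ; *-assoc = λ f g h → coeffwise (conv-assoc f g h)
        ; *-identity = (λ f → coeffwise (identityˡ f))
                     , (λ f → coeffwise λ n → ≡.trans (conv-comm f 1# n) (identityˡ f n))
        ; distrib = (λ f g h → coeffwise λ n → ≡.trans (conv-comm f _ n)
                      (≡.trans (conv-distribʳ f g h n)
                        (cong₂ Z._+_ (conv-comm g f n) (conv-comm h f n))))
                  , (λ f g h → coeffwise (conv-distribʳ f g h))
        }
      ; *-comm = λ f g → coeffwise (conv-comm f g)
      }
      where
      identityˡ : ∀ f n → conv 1# f n ≡ f n
      identityˡ f n = ≡.trans (conv-const 1ℤ f n) (ℤₚ.*-identityˡ _)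

  seriesRing : CommutativeRing 0ℓ 0ℓ
  seriesRing = record { isCommutativeRing = isCommutativeRing }

  almostRing : AlmostCommutativeRing 0ℓ 0ℓ
  almostRing = fromCommutativeRing seriesRing

  opaque
    unfolding _+_

    const-+ : ∀ x y → const (x Z.+ y) ≈ const x + const y
    const-+ x y = coeffwise λ { zero → ≡.refl ; (suc n) → ≡.refl }

    const-* : ∀ x y → const (x Z.* y) ≈ const x * const y
    const-* x y = coeffwise λ
      { zero → ≡.refl ; (suc n) → ≡.sym (≡.trans (conv-const x (const y) (suc n)) (ℤₚ.*-zeroʳ x)) }

    const-neg : ∀ x → const (Z.- x) ≈ - const x
    const-neg x = coeffwise λ { zero → ≡.refl ; (suc n) → ≡.refl }

  constHom : Z.+-*-rawRing -Raw-AlmostCommutative⟶ almostRing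
  constHom = record
    { ⟦_⟧    = const
    ; +-homo = const-+
    ; *-homo = const-*
    ; -‿homo = const-neg
    ; 0-homo = coeffwise λ _ → ≡.refl
    ; 1-homo = coeffwise λ _ → ≡.refl
    }

  const-≟ : ∀ x y → Maybe (const x ≈ const y)
  const-≟ x y with x ℤₚ.≟ y
  ... | yes p = just (coeffwise λ n → cong (λ z → const z n) p)
  ... | no  _ = nothing

  -- Taking the coefficients in the integers, embedded by `const`, lets the solver compute with
  -- numerals such as `const (+ 2)` and `const (+ 8)`.
  module Solver = Algebra.Solver.Ring Z.+-*-rawRing almostRing constHom const-≟

  open CommutativeRing seriesRing public
    using (setoid; refl; sym; trans; +-cong; +-congˡ; +-congʳ; *-cong; *-congˡ; *-congʳ; -‿cong;
           *-identityˡ; *-identityʳ; +-identityˡ; +-identityʳ; zeroˡ; *-assoc; *-comm; reflexive)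

-- Congruences of series modulo an integer and a series.

module Congruence where

  open FormalSeries
  import Relation.Binary.Reasoning.Setoid as SetoidReasoning

  private variable
    x y z x′ y′ a b l r m m′ : Series
    c d : ℤ

  module ≈-Reasoning = SetoidReasoning setoid

  -- Replacing a by b in l costs c * (a − b); moved so that both sides are polynomials, the rest is
  -- left to the ring solver.
  linear : ∀ c → a ≈ b → l + c * b ≈ r + c * a → l ≈ r
  linear {a} {b} {l} {r} c a≈b e = begin
    l                     ≈⟨ solve 2 (λ l x → l := (l :+ x) :- x) refl l (c * b) ⟩
    (l + c * b) + - (c * b) ≈⟨ +-cong e (-‿cong (*-congˡ (sym a≈b))) ⟩
    (r + c * a) + - (c * a) ≈⟨ solve 2 (λ l x → (l :+ x) :- x := l) refl r (c * a) ⟩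
    r                     ∎
    where
    open ≈-Reasoning
    open Solver

  infixr 8 _^_
  _^_ : Series → ℕ → Series
  x ^ zero  = 1#
  x ^ suc n = x * x ^ n

  ^-congˡ : ∀ n → x ≈ y → x ^ n ≈ y ^ n
  ^-congˡ zero    p = refl
  ^-congˡ (suc n) p = *-cong p (^-congˡ n p)

  ^-+ : ∀ x m n → x ^ (m ℕ.+ n) ≈ x ^ m * x ^ n
  ^-+ x zero    n = sym (*-identityˡ _)
  ^-+ x (suc m) n = trans (*-congˡ (^-+ x m n)) (sym (*-assoc _ _ _))

  ^-* : ∀ x m n → x ^ (m ℕ.* n) ≈ (x ^ n) ^ m
  ^-* x zero    n = refl
  ^-* x (suc m) n = trans (^-+ x n (m ℕ.* n)) (*-congˡ (^-* x m n))

  *-^ : ∀ x y n → (x * y) ^ n ≈ x ^ n * y ^ n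
  *-^ x y zero    = sym (*-identityˡ _)
  *-^ x y (suc n) = trans (*-congˡ (*-^ x y n))
    (solve 4 (λ x y p r → x :* y :* (p :* r) := x :* p :* (y :* r)) refl x y (x ^ n) (y ^ n))
    where open Solver

  -- Congruence modulo the ideal generated by the integer c and the series m.
  record Cong (c : ℤ) (m x y : Series) : Set where
    constructor mod-witness
    field
      s t : Series
      eq : x ≈ y + (const c * s + m * t)

  module _ where
    open Solver

    ≈⇒mod : x ≈ y → Cong c m x y
    ≈⇒mod {x} {y} {c} {m} e = mod-witness 0# 0# (trans e
      (solve 3 (λ y c m → y := y :+ (c :* con 0ℤ :+ m :* con 0ℤ)) refl y (const c) m))

    mod-sym : Cong c m x y → Cong c m y x
    mod-sym {c} {m} {x} {y} (mod-witness s t e) = mod-witness (- s) (- t)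
      (linear (- 1#) e (solve 6 (λ c m x y s t →
         y :+ (:- con 1ℤ) :* (y :+ (c :* s :+ m :* t)) := x :+ (c :* (:- s) :+ m :* (:- t)) :+
           (:- con 1ℤ) :* x)
         refl (const c) m x y s t))

    mod-trans : Cong c m x y → Cong c m y z → Cong c m x z
    mod-trans {c} {m} {x} {y} {z} (mod-witness s t e) (mod-witness s′ t′ e′) =
      mod-witness (s + s′) (t + t′) (trans e (trans (+-congʳ e′)
        (solve 7 (λ c m z s t s′ t′ → z :+ (c :* s′ :+ m :* t′) :+ (c :* s :+ m :* t)
           := z :+ (c :* (s :+ s′) :+ m :* (t :+ t′))) refl (const c) m z s t s′ t′)))

    mod-+ : Cong c m x y → Cong c m x′ y′ → Cong c m (x + x′) (y + y′)
    mod-+ {c} {m} {x} {y} {x′} {y′} (mod-witness s t e) (mod-witness s′ t′ e′) =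
      mod-witness (s + s′) (t + t′) (trans (+-cong e e′)
        (solve 8 (λ c m y y′ s t s′ t′ → (y :+ (c :* s :+ m :* t)) :+ (y′ :+ (c :* s′ :+ m :* t′))
           := (y :+ y′) :+ (c :* (s :+ s′) :+ m :* (t :+ t′))) refl (const c) m y y′ s t s′ t′))

    mod-* : Cong c m x y → Cong c m x′ y′ → Cong c m (x * x′) (y * y′)
    mod-* {c} {m} {x} {y} {x′} {y′} (mod-witness s t e) (mod-witness s′ t′ e′) =
      -- From x x′ - y y′ = (x - y) y′ + x (x′ - y′).
      mod-witness (s * y′ + x * s′) (t * y′ + x * t′) (trans (*-congˡ e′)
        (linear y′ e (solve 9 (λ c m x y y′ s t s′ t′ →
           x :* (y′ :+ (c :* s′ :+ m :* t′)) :+ y′ :* (y :+ (c :* s :+ m :* t))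
           := y :* y′ :+ (c :* (s :* y′ :+ x :* s′) :+ m :* (t :* y′ :+ x :* t′)) :+ y′ :* x)
           refl (const c) m x y y′ s t s′ t′)))

    mod-refl : Cong c m x x
    mod-refl = ≈⇒mod refl

    -- The theta identities are proved with integer modulus 0 and often modulo a higher power than
    -- needed; this brings them into congruences modulo 2 and 8.
    mod-weaken : ∀ z → m′ ≈ m * z → Cong 0ℤ m′ x y → Cong c m x y
    mod-weaken {m′} {m} {x} {y} {c} z m′≈mz (mod-witness s t e) = mod-witness 0# (z * t)
      (trans e (linear t m′≈mz (solve 7 (λ y m′ m c z s t →
         y :+ (con 0ℤ :* s :+ m′ :* t) :+ t :* (m :* z) := y :+ (c :* con 0ℤ :+ m :* (z :* t)) :+
           t :* m′)
         refl y m′ m (const c) z s t)))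

  mod-sq : Cong c m x y → Cong c m (x * x) (y * y)
  mod-sq p = mod-* p p

-- The theta series ψ and its square.

module Theta where

  open FormalSeries
  open Congruence

  nil : ∀ {n} → Solver.Polynomial n
  nil = Solver.con 0ℤ

  one : ∀ {n} → Solver.Polynomial n
  one = Solver.con 1ℤ

  -- The base `q` is arbitrary because ψ(q) and ψ(-q) both occur; it is taken to be `X` and `- X`.
  module Products (q : Series) where

    Q : Series
    Q = q * q

    odd : ℕ → Series
    odd zero    = q
    odd (suc n) = Q * odd n

    odd≈ : ∀ n → odd n ≈ q * Q ^ n
    odd≈ zero    = sym (*-identityʳ _)
    odd≈ (suc n) = trans (*-congˡ (odd≈ n)) (solve 3 (λ q Q x → Q :* (q :* x) := q :* (Q :* x)) refl
      q Q _)
      where open Solver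

    odd≈^ : ∀ n → odd n ≈ q ^ suc (n ℕ.+ n)
    odd≈^ zero    = sym (*-identityʳ _)
    odd≈^ (suc n) rewrite ℕₚ.+-suc n n = trans (*-congˡ (odd≈^ n)) (*-assoc _ _ _)

    Q^≈^ : ∀ n → Q ^ suc n ≈ q ^ suc (suc (n ℕ.+ n))
    Q^≈^ zero    = *-assoc _ _ _
    Q^≈^ (suc n) rewrite ℕₚ.+-suc n n = trans (*-congˡ (Q^≈^ n)) (*-assoc _ _ _)

    -- The triangular exponents in pairs: (2n)(2n+1)/2 and (2n+1)(2n+2)/2.
    triangular-sum : ℕ → Series
    triangular-sum zero    = 0#
    triangular-sum (suc n) = triangular-sum n +
      (q ^ (n ℕ.* suc (n ℕ.+ n)) + q ^ (suc n ℕ.* suc (n ℕ.+ n)))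

    odd^≈ : ∀ n k → odd n ^ k ≈ q ^ (k ℕ.* suc (n ℕ.+ n))
    odd^≈ n k = trans (^-congˡ k (odd≈^ n)) (sym (^-* q k (suc (n ℕ.+ n))))

    -- Gauss's product for ψ, in finite form.

    module Gauss (o w : ℕ → Series)
      (o-inverse : ∀ n → o n * (1# + - odd n) ≈ 1#)
      (w-inverse : ∀ n → w n * (1# + - Q ^ suc n) ≈ 1#) where

      -- The truncated product for ψ(q) and its reciprocal. The inverses `o` and `w` are parameters
      -- since 1/(1 - q^(2n+1)) has different coefficients at `X` and at `- X`.
      Π Π⁻¹ : ℕ → Series
      Π zero    = 1#
      Π (suc n) = Π n * ((1# + - Q ^ suc n) * o n)
      Π⁻¹ zero    = 1#
      Π⁻¹ (suc n) = Π⁻¹ n * ((1# + - odd n) * w n)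

      Π-inverse : ∀ n → Π n * Π⁻¹ n ≈ 1#
      Π-inverse zero    = *-identityˡ _
      Π-inverse (suc n) = linear ((1# + - x) * o n * (w n * (1# + - y))) (Π-inverse n)
        (linear (o n * (1# + - x)) (w-inverse n) (linear 1# (o-inverse n)
          (solve 6 (λ p p′ x o y w →
            p :* ((one :- y) :* o) :* (p′ :* ((one :- x) :* w))
              :+ (one :- x) :* o :* (w :* (one :- y)) :* one
              :+ o :* (one :- x) :* one
              :+ one :* one
            := one
              :+ (one :- x) :* o :* (w :* (one :- y)) :* (p :* p′)
              :+ o :* (one :- x) :* (w :* (one :- y))
              :+ one :* (o :* (one :- x))) refl (Π n) (Π⁻¹ n) x (o n) y (w n))))
        where
        open Solver
        x = odd n
        y = Q ^ suc n

      -- Partial sums of the q-binomial series ∑ (q; Q)_j / (Q; Q)_j y^j.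
      B : Series → ℕ → Series
      B y zero    = 0#
      B y (suc k) = B y k + Π⁻¹ k * y ^ k

      -- Shanks' telescoping sum; it is used at y = q^(2n+1), where 1 − qy = 1 − Q^(n+1) and 1 − y are
      -- the factors of Π (n + 1) / Π n.
      B-shift : ∀ y k → (1# + - (q * y)) * B (Q * y) k
        ≈ (1# + - y) * B y k + Π⁻¹ k * y ^ k * (1# + - Q ^ k)
      B-shift y zero    = solve 2 (λ q y → (one :- q :* y) :* nil :=
         (one :- y) :* con 0ℤ :+ one :* one :* (one :- one)) refl q y
        where open Solver
      B-shift y (suc k) =
        (linear 1# (B-shift y k)
        (linear ((1# + - (q * y)) * p) (*-^ Q y k)
        (linear (p * y * z) (odd≈ k)
        (linear (- (p * (y * z) * (1# + - od))) (w-inverse k)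
        (solve 10 (λ b b1 od p q w0 x y z z1 →
            (one :- q :* y) :* (b1 :+ p :* z1)
            :+ one :* ((one :- y) :* b :+ p :* z :* (one :- x))
            :+ (one :- q :* y) :* p :* (x :* z)
            :+ p :* y :* z :* (q :* x)
            :+ (:- (p :* (y :* z) :* (one :- od))) :* one
          := (one :- y) :* (b :+ p :* z) :+ p :* ((one :- od) :* w0) :* (y :* z)
            :* (one :- q :* q :* x)
            :+ one :* ((one :- q :* y) :* b1)
            :+ (one :- q :* y) :* p :* z1
            :+ p :* y :* z :* od
            :+ (:- (p :* (y :* z) :* (one :- od))) :* (w0 :* (one :- q :* q :* x)))
          refl b b1 od p q w0 x y z z1)))))
        where
        open Solver
        b = B y k
        b1 = B (Q * y) k
        p = Π⁻¹ k
        x = Q ^ k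
        z = y ^ k
        z1 = (Q * y) ^ k
        od = odd k
        w0 = w k

      -- The triangular powers of q written through y = `odd n`, because the induction step of `Π*B`
      -- produces them as y^n + y^(n+1).
      Θ : ℕ → Series
      Θ zero    = 0#
      Θ (suc n) = Θ n + (odd n ^ n + odd n ^ suc n)

      Θ≈ : ∀ n → Θ n ≈ triangular-sum n
      Θ≈ zero    = refl
      Θ≈ (suc n) = +-cong (Θ≈ n) (+-cong (odd^≈ n n) (odd^≈ n (suc n)))

      -- Put y = `odd n`. By `B-shift` the value at n + 1 exceeds that at n by y^n (1 - Q^n + Q^n (1
      -- - q y)) / (1 - y). Since q Q^n = y, this is y^n (1 - y²)/(1 - y) = y^n + y^(n+1).
      Π*B : ∀ n → Π n * B (odd n) n ≈ Θ n
      Π*B zero    = *-identityˡ _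
      Π*B (suc n) =
        (linear 1# (Π*B n)
        (linear (p * o0) (B-shift y n)
        (linear (p * o0 * (1# + - (q * y)) * p1) (*-^ Q y n)
        (linear (p * o0 * q * (b1 + p1 * z1) + o0 * z * y) (odd≈ n)
        (linear (p * b + z + y * z) (o-inverse n)
        (linear (o0 * z * (1# + - (q * x * y))) (Π-inverse n)
        (solve 11 (λ b b1 o0 p p1 q th x y z z1 →
            p :* ((one :- q :* q :* x) :* o0) :* (b1 :+ p1 :* z1)
            :+ one :* th
            :+ p :* o0 :* ((one :- y) :* b :+ p1 :* z :* (one :- x))
            :+ p :* o0 :* (one :- q :* y) :* p1 :* (x :* z)
            :+ (p :* o0 :* q :* (b1 :+ p1 :* z1) :+ o0 :* z :* y) :* (q :* x)
            :+ (p :* b :+ z :+ y :* z) :* one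
            :+ o0 :* z :* (one :- q :* x :* y) :* one
          := th :+ (z :+ y :* z)
            :+ one :* (p :* b)
            :+ p :* o0 :* ((one :- q :* y) :* b1)
            :+ p :* o0 :* (one :- q :* y) :* p1 :* z1
            :+ (p :* o0 :* q :* (b1 :+ p1 :* z1) :+ o0 :* z :* y) :* y
            :+ (p :* b :+ z :+ y :* z) :* (o0 :* (one :- y))
            :+ o0 :* z :* (one :- q :* x :* y) :* (p :* p1))
          refl b b1 o0 p p1 q th x y z z1)))))))
        where
        open Solver
        p = Π n
        p1 = Π⁻¹ n
        y = odd n
        x = Q ^ n
        b = B y n
        b1 = B (Q * y) n
        o0 = o n
        z = y ^ n
        z1 = (Q * y) ^ n
        th = Θ n

      -- Of the terms of `B y` only the one of index 0 is free of y, and it is 1; so `Π*B` loses its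
      -- factor `B` modulo y = `odd (suc n)`.
      Θ≡Π : ∀ n → Cong 0ℤ (odd (suc n)) (Θ (suc n)) (Π (suc n))
      Θ≡Π n = mod-trans (≈⇒mod (sym (Π*B (suc n)))) (mod-trans (mod-* mod-refl (B≡1 n))
        (≈⇒mod (*-identityʳ _)))
        where
        y = odd (suc n)
        B≡1 : ∀ k → Cong 0ℤ y (B y (suc k)) 1#
        B≡1 zero    = ≈⇒mod (solve 0 (nil :+ one :* one := one) refl)
          where open Solver
        B≡1 (suc k) = mod-witness 0# (t + Π⁻¹ (suc k) * y ^ k)
          (linear 1# e
          (solve 6 (λ b p s t y z →
              b :+ p :* (y :* z)
              :+ one :* (one :+ (nil :* s :+ y :* t))
            := one :+ (nil :* nil :+ y :* (t :+ p :* z))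
              :+ one :* b)
            refl b p s t y z))
          where
          open Solver
          open Cong (B≡1 k) using (s; t) renaming (eq to e)
          b = B y (suc k)
          p = Π⁻¹ (suc k)
          z = y ^ k

      -- The Lambert series for ψ(q)², from a finite partial fraction expansion.

      v F t P Λ : ℕ → Series
      v zero    = 1#
      v (suc n) = v n * w n
      F zero    = 1#
      F (suc n) = F n * (1# + - Q ^ suc n)
      P zero    = 1#
      P (suc n) = P n * o n
      t zero    = 1#
      t (suc k) = - (t k * Q ^ suc k)
      Λ zero    = 0#
      Λ (suc k) = Λ k + t k * (1# + q * Q ^ k) * o k

      -- With n = i + k + 1, `v i` and `V k i` are the reciprocals of (Q; Q)_(n-1-k) and (Q;
      -- Q)_(n+k); their product with `t k` = (-1)^k q^(k²+k) is the k-th residue.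
      V : ℕ → ℕ → Series
      V k i = v (suc (k ℕ.+ k ℕ.+ i))

      v-step : ∀ n → v (suc n) * (1# + - Q ^ suc n) ≈ v n
      v-step n =
        (linear v0 (w-inverse n)
        (solve 3 (λ v0 w0 x →
            v0 :* w0 :* (one :- x)
            :+ v0 :* one
          := v0
            :+ v0 :* (w0 :* (one :- x)))
          refl v0 w0 x))
        where
        open Solver
        v0 = v n
        w0 = w n
        x = Q ^ suc n

      V-sucʳ : ∀ k i → V k i ≈ V k (suc i) * (1# + - (Q * Q * Q ^ k * Q ^ k * Q ^ i))
      V-sucʳ k i rewrite ℕₚ.+-suc (k ℕ.+ k) i = trans (sym (v-step m))
        (*-congˡ (+-congˡ (-‿cong
          (trans (*-congˡ (*-congˡ (trans (^-+ Q (k ℕ.+ k) i) (*-congʳ (^-+ Q k k)))))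
          (solve 3 (λ Q a b → Q :* (Q :* (a :* a :* b)) := Q :* Q :* a :* a :* b) refl Q (Q ^ k)
            (Q ^ i))))))
        where
        open Solver
        m = suc (k ℕ.+ k ℕ.+ i)

      V-sucˡ : ∀ k i → V k (suc i) ≈ V (suc k) i * (1# + - (Q * Q * Q * Q ^ k * Q ^ k * Q ^ i))
      V-sucˡ k i rewrite ℕₚ.+-suc (k ℕ.+ k) i | ℕₚ.+-suc k k = trans (sym (v-step (suc m)))
        (*-congˡ (+-congˡ (-‿cong
          (trans (*-congˡ (*-congˡ (*-congˡ (trans (^-+ Q (k ℕ.+ k) i) (*-congʳ (^-+ Q k k))))))
          (solve 3 (λ Q a b → Q :* (Q :* (Q :* (a :* a :* b))) := Q :* Q :* Q :* a :* a :* b) refl Q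
            (Q ^ k) (Q ^ i))))))
        where
        open Solver
        m = suc (k ℕ.+ k ℕ.+ i)

      -- The sum of f (i + k ∸ j) j over j ≤ k.
      diag : (ℕ → ℕ → Series) → ℕ → ℕ → Series
      diag f i zero    = f i zero
      diag f i (suc k) = diag f (suc i) k + f i (suc k)

      -- With n = i + k + 1, s is the k-th term of the partial fraction decomposition in z, at z = q, of
      -- 1/∏ (1 − z Q^j) over −n ≤ j < n, folded by k ↔ −1−k.  Its sum over k is ∏ 1/(1 − q^(2j+1))² over
      -- j < n; h is the defect of the recurrence in n, and sums to zero.
      s h : ℕ → ℕ → Series
      s i k = t k * (1# + q * Q ^ k) * o k * (v i * V k i)
      h i k = t k * Q ^ i * (1# + - (Q * Q ^ k * Q ^ k)) * (v i * V k i)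

      -- A telescoping sum: i + k is constant along a diagonal, so the induction only adds one term
      -- to a partial sum. The factor 1 - Q^i on the right makes the complete sum, at i = 0, vanish.
      diag-h : ∀ i k → (1# + - Q ^ (i ℕ.+ k)) * diag h i k ≈
        Q ^ (i ℕ.+ k) * t k * (1# + - (Q * Q ^ k)) * (1# + - Q ^ i) * (v i * V k i)
      diag-h i zero rewrite ℕₚ.+-identityʳ i =
        solve 4 (λ q b x y → (one :- b) :* (one :* b :* (one :- q :* q :* one :* one) :* (x :* y))
          :=
           b :* one :* (one :- q :* q :* one) :* (one :- b) :* (x :* y)) refl q (Q ^ i) (v i)
             (V zero i)
        where open Solver
      diag-h i (suc k) rewrite ℕₚ.+-suc i k =
        (linear 1# (diag-h (suc i) k)
        (linear (R * N * t0 * (1# + - (R * a)) * V1) (v-step i)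
        (linear (R * N * t0 * (1# + - (R * a)) * vi) (V-sucˡ k i)
        (linear (R * t0 * vi * V2 * ((1# + - (R * a)) * (1# + - (R * R * R * a * a * b)) + R * a * b
          * (1# + - (R * R * R * a * a)) + R * a * (1# + - (R * R * a)) * (1# + - b))) (^-+ Q i k)
        (solve 10 (λ N R V1 V2 a b d1 t0 v1 vi →
            (one :- R :* N) :* (d1 :+ (:- (t0 :* (R :* a))) :* b
              :* (one :- R :* (R :* a) :* (R :* a)) :* (vi :* V2))
            :+ one :* (R :* N :* t0 :* (one :- R :* a) :* (one :- R :* b) :* (v1 :* V1))
            :+ R :* N :* t0 :* (one :- R :* a) :* V1 :* vi
            :+ R :* N :* t0 :* (one :- R :* a) :* vi :* (V2 :* (one :- R :* R :* R :* a :* a :* b))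
            :+ R :* t0 :* vi :* V2 :* ((one :- R :* a) :* (one :- R :* R :* R :* a :* a :* b) :+
              R :* a :* b :* (one :- R :* R :* R :* a :* a) :+ R :* a :* (one :- R :* R :* a)
                :* (one :- b)) :* (b :* a)
          := R :* N :* (:- (t0 :* (R :* a))) :* (one :- R :* (R :* a)) :* (one :- b) :* (vi :* V2)
            :+ one :* ((one :- R :* N) :* d1)
            :+ R :* N :* t0 :* (one :- R :* a) :* V1 :* (v1 :* (one :- R :* b))
            :+ R :* N :* t0 :* (one :- R :* a) :* vi :* V1
            :+ R :* t0 :* vi :* V2 :* ((one :- R :* a) :* (one :- R :* R :* R :* a :* a :* b) :+
              R :* a :* b :* (one :- R :* R :* R :* a :* a) :+ R :* a :* (one :- R :* R :* a)
                :* (one :- b)) :* N)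
          refl N R V1 V2 a b d1 t0 v1 vi)))))
        where
        open Solver
        R = Q
        N = Q ^ (i ℕ.+ k)
        a = Q ^ k
        b = Q ^ i
        d1 = diag h (suc i) k
        t0 = t k
        vi = v i
        v1 = v (suc i)
        V1 = V k (suc i)
        V2 = V (suc k) i

      -- With n = i + k + 1 and u = q^(2k+1), (1 - q^(2n+1))² = (1 - Q^(n-k)) (1 - Q^(n+k+1)) +
      -- Q^(n-k) (1 - u)². The product of two factors lowers the indices of `v` and `V`, giving
      -- `s i k`; in the other summand one factor 1 - u cancels `o k` and what is left is `h`.
      s-step : ∀ i k → (1# + - odd (suc (i ℕ.+ k))) * (1# + - odd (suc (i ℕ.+ k))) * s (suc i) k
        ≈ s i k + h (suc i) k
      s-step i k =
        (linear (t0 * (1# + q * a) * o0 * V0) (v-step i)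
        (linear (- (t0 * (1# + q * a) * o0 * v1 * (1# + - (q * q * b)))) (V-sucʳ k i)
        (linear (t0 * (q * q) * b * (1# + - (q * a)) * (1# + q * a) * v1 * V1) (o-inverse k)
        (linear (t0 * (q * q) * b * (1# + - (q * a)) * (1# + q * a) * v1 * V1 * o0) (odd≈ k)
        (linear (- (q * q * (const (+ 2) + - (q * q * Y) + - (q * q * q * N)) * t0 * (1# + q * a)
          * o0 * v1 * V1)) (odd≈ (i ℕ.+ k))
        (linear (- (q * q * q * (const (+ 2) + - (q * q * q * N) + - (q * q * q * b * a)) * t0
          * (1# + q * a) * o0 * v1 * V1)) (^-+ Q i k)
        (solve 12 (λ N V0 V1 Y a b o0 od q t0 v1 vi →
            (one :- q :* q :* Y) :* (one :- q :* q :* Y)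
              :* (t0 :* (one :+ q :* a) :* o0 :* (v1 :* V1))
            :+ t0 :* (one :+ q :* a) :* o0 :* V0 :* vi
            :+ (:- (t0 :* (one :+ q :* a) :* o0 :* v1 :* (one :- q :* q :* b)))
              :* (V1 :* (one :- q :* q :* (q :* q) :* a :* a :* b))
            :+ t0 :* (q :* q) :* b :* (one :- q :* a) :* (one :+ q :* a) :* v1 :* V1 :* one
            :+ t0 :* (q :* q) :* b :* (one :- q :* a) :* (one :+ q :* a) :* v1 :* V1 :* o0
              :* (q :* a)
            :+ (:- (q :* q :* (con (+ 2) :- q :* q :* Y :- q :* q :* q :* N) :* t0
              :* (one :+ q :* a) :* o0 :* v1 :* V1)) :* (q :* N)
            :+ (:- (q :* q :* q :* (con (+ 2) :- q :* q :* q :* N :- q :* q :* q :* b :* a) :* t0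
              :* (one :+ q :* a) :* o0 :* v1 :* V1)) :* (b :* a)
          := t0 :* (one :+ q :* a) :* o0 :* (vi :* V0) :+ t0 :* (q :* q :* b)
            :* (one :- q :* q :* a :* a) :* (v1 :* V1)
            :+ t0 :* (one :+ q :* a) :* o0 :* V0 :* (v1 :* (one :- q :* q :* b))
            :+ (:- (t0 :* (one :+ q :* a) :* o0 :* v1 :* (one :- q :* q :* b))) :* V0
            :+ t0 :* (q :* q) :* b :* (one :- q :* a) :* (one :+ q :* a) :* v1 :* V1
              :* (o0 :* (one :- od))
            :+ t0 :* (q :* q) :* b :* (one :- q :* a) :* (one :+ q :* a) :* v1 :* V1 :* o0 :* od
            :+ (:- (q :* q :* (con (+ 2) :- q :* q :* Y :- q :* q :* q :* N) :* t0
              :* (one :+ q :* a) :* o0 :* v1 :* V1)) :* Y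
            :+ (:- (q :* q :* q :* (con (+ 2) :- q :* q :* q :* N :- q :* q :* q :* b :* a) :* t0
              :* (one :+ q :* a) :* o0 :* v1 :* V1)) :* N)
          refl N V0 V1 Y a b o0 od q t0 v1 vi)))))))
        where
        open Solver
        Y = odd (i ℕ.+ k)
        od = odd k
        N = Q ^ (i ℕ.+ k)
        a = Q ^ k
        b = Q ^ i
        t0 = t k
        o0 = o k
        vi = v i
        v1 = v (suc i)
        V0 = V k i
        V1 = V k (suc i)

      -- `m` is linked to i + k by an equation because it must stay fixed while the recursion trades
      -- k for i.
      diag-s : ∀ {m} i k → m ≡ i ℕ.+ k →
        (1# + - odd (suc m)) * (1# + - odd (suc m)) * diag s (suc i) k
          ≈ diag s i k + diag h (suc i) k
      diag-s i zero    ≡.refl = s-step i zero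
      diag-s {m} i (suc k) e =
        (linear 1# (diag-s (suc i) k (≡.trans e (ℕₚ.+-suc i k)))
        (linear 1# step
        (solve 7 (λ Y d1 d2 e2 h1 s0 s1 →
            Y :* Y :* (d2 :+ s1)
            :+ one :* (d1 :+ e2)
            :+ one :* (s0 :+ h1)
          := d1 :+ s0 :+ (e2 :+ h1)
            :+ one :* (Y :* Y :* d2)
            :+ one :* (Y :* Y :* s1))
          refl Y d1 d2 e2 h1 s0 s1)))
        where
        open Solver
        Y = 1# + - odd (suc m)
        d1 = diag s (suc i) k
        d2 = diag s (suc (suc i)) k
        e2 = diag h (suc (suc i)) k
        s0 = s i (suc k)
        s1 = s (suc i) (suc k)
        h1 = h (suc i) (suc k)
        step : Y * Y * s1 ≈ s0 + h1
        step = ≡.subst (λ m → (1# + - odd (suc m)) * (1# + - odd (suc m)) * s1 ≈ s0 + h1) (≡.sym e)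
          (s-step i (suc k))

      -- `diag-h` gives the sum times 1 - Q^(k+1), which has the inverse `w k`. For a diagonal of
      -- length one that factor would be 0, hence `suc k`.
      diag-h-zero : ∀ k → diag h zero (suc k) ≈ 0#
      diag-h-zero k =
        (linear (- d) (w-inverse k)
        (linear w0 (diag-h zero (suc k))
        (solve 6 (λ d r0 t0 vv w0 x →
            d
            :+ (:- d) :* one
            :+ w0 :* (x :* t0 :* r0 :* (one :- one) :* vv)
          := nil
            :+ (:- d) :* (w0 :* (one :- x))
            :+ w0 :* ((one :- x) :* d))
          refl d r0 t0 vv w0 x)))
        where
        open Solver
        d = diag h zero (suc k)
        w0 = w k
        x = Q ^ suc k
        t0 = t (suc k)
        r0 = 1# + - (Q * Q ^ suc k)
        vv = v zero * V (suc k) zero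

      -- Passing to n + 1 also adds the last term `s zero (suc n)`. Times (1 - y)², with y =
      -- `odd (suc n)`, it equals `h zero (suc n)`, which completes the sum of the defects, and by
      -- `diag-h-zero` this is zero.
      diag-s-zero : ∀ n → diag s zero n ≈ P (suc n) * P (suc n)
      diag-s-zero zero =
        (linear (- ((1# + q) * o0 * w0)) (o-inverse zero)
        (linear (o0 * o0) (w-inverse zero)
        (solve 3 (λ o0 q w0 →
            one :* (one :+ q :* one) :* o0 :* (one :* (one :* w0))
            :+ (:- ((one :+ q) :* o0 :* w0)) :* one
            :+ o0 :* o0 :* one
          := one :* o0 :* (one :* o0)
            :+ (:- ((one :+ q) :* o0 :* w0)) :* (o0 :* (one :- q))
            :+ o0 :* o0 :* (w0 :* (one :- q :* q :* one)))
          refl o0 q w0)))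
        where
        open Solver
        o0 = o zero
        w0 = w zero
      diag-s-zero (suc n) =
        (linear (o1 * o1) (diag-s zero n ≡.refl)
        (linear (o1 * o1) (diag-s-zero n)
        (linear (o1 * o1) (diag-h-zero n)
        (linear (- (d1 * (o1 * (1# + - y) + 1#) + t0 * (1# + q * a) * o1 * V0)) (o-inverse (suc n))
        (linear (- (t0 * (1# + q * a) * o1 * V0 * o1)) (odd≈ (suc n))
        (solve 10 (λ V0 a d0 d1 e1 o1 p q t0 y →
            d1 :+ t0 :* (one :+ q :* a) :* o1 :* (one :* V0)
            :+ o1 :* o1 :* (d0 :+ e1)
            :+ o1 :* o1 :* (p :* p)
            :+ o1 :* o1 :* nil
            :+ (:- (d1 :* (o1 :* (one :- y) :+ one) :+ t0 :* (one :+ q :* a) :* o1 :* V0)) :* one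
            :+ (:- (t0 :* (one :+ q :* a) :* o1 :* V0 :* o1)) :* (q :* a)
          := p :* o1 :* (p :* o1)
            :+ o1 :* o1 :* ((one :- y) :* (one :- y) :* d1)
            :+ o1 :* o1 :* d0
            :+ o1 :* o1 :* (e1 :+ t0 :* one :* (one :- q :* q :* a :* a) :* (one :* V0))
            :+ (:- (d1 :* (o1 :* (one :- y) :+ one) :+ t0 :* (one :+ q :* a) :* o1 :* V0))
              :* (o1 :* (one :- y))
            :+ (:- (t0 :* (one :+ q :* a) :* o1 :* V0 :* o1)) :* y)
          refl V0 a d0 d1 e1 o1 p q t0 y))))))
        where
        open Solver
        d0 = diag s zero n
        d1 = diag s (suc zero) n
        e1 = diag h (suc zero) n
        y = odd (suc n)
        a = Q ^ suc n
        t0 = t (suc n)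
        o1 = o (suc n)
        V0 = V (suc n) zero
        p = P (suc n)

      F-inverse : ∀ n → F n * v n ≈ 1#
      F-inverse zero    = *-identityˡ _
      F-inverse (suc n) =
        (linear (f * v0) (w-inverse n)
        (linear 1# (F-inverse n)
        (solve 4 (λ f v0 w0 x →
            f :* (one :- x) :* (v0 :* w0)
            :+ f :* v0 :* one
            :+ one :* one
          := one
            :+ f :* v0 :* (w0 :* (one :- x))
            :+ one :* (f :* v0))
          refl f v0 w0 x)))
        where
        open Solver
        f = F n
        v0 = v n
        w0 = w n
        x = Q ^ suc n

      Π≈F*P : ∀ n → Π n ≈ F n * P n
      Π≈F*P zero    = sym (*-identityˡ _)
      Π≈F*P (suc n) =
        (linear (x * o0) (Π≈F*P n)
        (solve 5 (λ c f o0 p x →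
            c :* (x :* o0)
            :+ x :* o0 :* (f :* p)
          := f :* x :* (p :* o0)
            :+ x :* o0 :* c)
          refl c f o0 p x))
        where
        open Solver
        c = Π n
        f = F n
        p = P n
        o0 = o n
        x = 1# + - Q ^ suc n

      F-mod : ∀ m j → Cong 0ℤ (Q ^ suc m) (F (j ℕ.+ m)) (F m)
      F-mod m zero    = mod-refl
      F-mod m (suc j) = mod-trans (mod-* (F-mod m j) (mod-witness 0# (- Q ^ j)
        (linear (- R) (^-+ Q j m)
        (solve 4 (λ R a b x →
            one :- R :* x
            :+ (:- R) :* (b :* a)
          := one :+ (nil :* nil :+ R :* a :* (:- b))
            :+ (:- R) :* x)
          refl R a b x))
        )) (≈⇒mod (*-identityʳ _))
        where
        open Solver
        R = Q
        x = Q ^ (j ℕ.+ m)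
        a = Q ^ m
        b = Q ^ j

      F*v-mod : ∀ {n} i j → n ≡ j ℕ.+ i → Cong 0ℤ (Q ^ suc i) (F n * v i) 1#
      F*v-mod i j ≡.refl = mod-trans (mod-* (F-mod i j) mod-refl) (≈⇒mod (F-inverse i))

      v*F-mod : ∀ {n} i j → n ≡ j ℕ.+ i → Cong 0ℤ (Q ^ suc i) (F i * v n) 1#
      v*F-mod i j ≡.refl = mod-trans (mod-* (mod-sym (F-mod i j)) mod-refl)
        (≈⇒mod (F-inverse (j ℕ.+ i)))

      t-factor : ℕ → Series
      t-factor zero    = 1#
      t-factor (suc k) = - t k

      t-divisible : ∀ k → t k ≈ Q ^ k * t-factor k
      t-divisible zero    = sym (*-identityˡ _)
      t-divisible (suc k) = solve 2 (λ t x → :- (t :* x) := x :* (:- t)) refl (t k) (Q ^ suc k)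
        where open Solver

      -- `F (suc n) * v i` is 1 only modulo Q^(i+1), which is weak for large k; the factor Q^k of
      -- `t k` supplies the rest of Q^(i+k+1).
      s-mod : ∀ {n} i k → n ≡ i ℕ.+ k →
        Cong 0ℤ (Q ^ suc n) (F (suc n) * F (suc n) * s i k) (t k * (1# + q * Q ^ k) * o k)
      s-mod i k ≡.refl = mod-witness 0# (t-factor k * (1# + q * Q ^ k) * o k * C.t)
        (linear (t0 * g * o0) C.eq
        (linear (g * o0 * R * b * ct) (t-divisible k)
        (linear (- (z * g * o0 * ct * R)) (^-+ Q i k)
        (solve 13 (λ N R V0 a b cs ct f g o0 t0 v0 z →
            f :* f :* (t0 :* g :* o0 :* (v0 :* V0))
            :+ t0 :* g :* o0 :* (one :* one :+ (nil :* cs :+ R :* b :* ct))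
            :+ g :* o0 :* R :* b :* ct :* (a :* z)
            :+ (:- (z :* g :* o0 :* ct :* R)) :* (b :* a)
          := t0 :* g :* o0 :+ (nil :* nil :+ R :* N :* (z :* g :* o0 :* ct))
            :+ t0 :* g :* o0 :* (f :* v0 :* (f :* V0))
            :+ g :* o0 :* R :* b :* ct :* t0
            :+ (:- (z :* g :* o0 :* ct :* R)) :* N)
          refl N R V0 a b cs ct f g o0 t0 v0 z))))
        where
        open Solver
        n : ℕ
        n = i ℕ.+ k
        Q^-split : Q ^ suc (suc n) ≈ Q ^ suc i * Q ^ suc k
        Q^-split = trans (reflexive (cong (λ j → Q ^ suc j) (≡.sym (ℕₚ.+-suc i k))))
          (^-+ Q (suc i) (suc k))
        shift : suc (k ℕ.+ k ℕ.+ i) ≡ k ℕ.+ suc n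
        shift = ≡.trans (cong suc (≡.trans (ℕₚ.+-assoc k k i) (cong (k ℕ.+_) (ℕₚ.+-comm k i))))
          (≡.sym (ℕₚ.+-suc k n))
        module C = Cong (mod-* (F*v-mod i (suc k) (cong suc (ℕₚ.+-comm i k)))
          (mod-weaken {m = Q ^ suc i} {c = 0ℤ} (Q ^ suc k) Q^-split (v*F-mod (suc n) k shift)))
        R = Q
        N = Q ^ n
        a = Q ^ k
        b = Q ^ i
        f = F (suc n)
        t0 = t k
        g = 1# + q * Q ^ k
        o0 = o k
        v0 = v i
        V0 = V k i
        z = t-factor k
        ct = C.t
        cs = C.s

      diag-s-mod : ∀ {n} i k → n ≡ i ℕ.+ k →
        Cong 0ℤ (Q ^ suc n) (F (suc n) * F (suc n) * diag s i k) (Λ (suc k))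
      diag-s-mod i zero    e = mod-trans (s-mod i zero e) (≈⇒mod (sym (+-identityˡ _)))
      diag-s-mod i (suc k) e = mod-trans
        (≈⇒mod (solve 3 (λ f x y → f :* (x :+ y) := f :* x :+ f :* y) refl _ _ _))
        (mod-+ (diag-s-mod (suc i) k (≡.trans e (ℕₚ.+-suc i k))) (s-mod i (suc k) e))
        where open Solver

      Π²≡Λ : ∀ n → Cong 0ℤ (Q ^ suc n) (Π (suc n) * Π (suc n)) (Λ (suc n))
      Π²≡Λ n = mod-trans (≈⇒mod
        (linear (c + f * p) (Π≈F*P (suc n))
        (linear (- (f * f)) (diag-s-zero n)
        (solve 4 (λ c d f p →
            c :* c
            :+ (c :+ f :* p) :* (f :* p)
            :+ (:- (f :* f)) :* (p :* p)
          := f :* f :* d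
            :+ (c :+ f :* p) :* c
            :+ (:- (f :* f)) :* d)
          refl c d f p)))
        )
        (diag-s-mod zero n ≡.refl)
        where
        open Solver
        c = Π (suc n)
        f = F (suc n)
        p = P (suc n)
        d = diag s zero n

-- The generating series of partitions with distinct even parts.

module GeneratingFunction where

  open FormalSeries
  open Congruence
  open Theta

  X : Series
  X zero    = 0ℤ
  X (suc n) = const 1ℤ n

  opaque
    unfolding _+_

    X*-zero : ∀ f → (X * f) 0 ≡ 0ℤ
    X*-zero f = ≡.refl

    X*-suc : ∀ f n → (X * f) (suc n) ≡ f n
    X*-suc f n = ≡.trans (ℤₚ.+-identityˡ _)
      (≡.trans (ConvolutionLaws.conv-cong (λ _ → ≡.refl) (λ _ → ≡.refl) n)
      (≡.trans (ConvolutionLaws.conv-const 1ℤ f n) (ℤₚ.*-identityˡ _)))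

    const*-at : ∀ c f n → (const c * f) n ≡ c Z.* f n
    const*-at c f n = ConvolutionLaws.conv-const c f n

  X^*-< : ∀ n f {k} → k < n → (X ^ n * f) k ≡ 0ℤ
  X^*-< (suc n) f {zero}  _ = ≡.trans (at (*-assoc X (X ^ n) f) 0) (X*-zero _)
  X^*-< (suc n) f {suc k} (s≤s k<n) =
    ≡.trans (at (*-assoc X (X ^ n) f) (suc k)) (≡.trans (X*-suc _ k) (X^*-< n f k<n))

  X^*-+ : ∀ n f k → (X ^ n * f) (n ℕ.+ k) ≡ f k
  X^*-+ zero    f k = at (*-identityˡ f) k
  X^*-+ (suc n) f k =
    ≡.trans (at (*-assoc X (X ^ n) f) (suc (n ℕ.+ k))) (≡.trans (X*-suc _ (n ℕ.+ k)) (X^*-+ n f k))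

  low-or-shifted : ∀ n (P : ℕ → Set) → (∀ k → k < n → P k) → (∀ k → P (n ℕ.+ k)) → ∀ k → P k
  low-or-shifted n P low high k with k ℕₚ.<? n
  ... | yes k<n = low k k<n
  ... | no  k≮n = ≡.subst P (ℕₚ.m+[n∸m]≡n (ℕₚ.≮⇒≥ k≮n)) (high (k ℕ.∸ n))

  divides-by-X^ : ∀ n f → (∀ k → k < n → f k ≡ 0ℤ) → f ≈ X ^ n * (λ k → f (n ℕ.+ k))
  divides-by-X^ n f low = coeffwise (low-or-shifted n (λ k → f k ≡ (X ^ n * _) k)
    (λ k k<n → ≡.trans (low k k<n) (≡.sym (X^*-< n _ k<n)))
    (λ k → ≡.sym (X^*-+ n _ k)))

  -- The integers have no 2-torsion, so 2 may be cancelled modulo X^n; modulo an integer this would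
  -- fail.
  halve : ∀ n x z → const (+ 2) * x ≈ X ^ n * z → ∃ λ y → x ≈ X ^ n * y
  halve n x z e = _ , divides-by-X^ n x λ k k<n → ℤₚ.*-cancelˡ-≡ (+ 2) (x k) 0ℤ
    (≡.trans (≡.sym (const*-at (+ 2) x k)) (≡.trans (at e k) (X^*-< n z k<n)))

  mod-coefficient : ∀ {c n x y k} → Cong c (X ^ n) x y → k < n → ∃ λ s → x k ≡ y k Z.+ c Z.* s
  mod-coefficient {c} {n} {x} {y} {k} (mod-witness s t e) k<n = s k , ≡.trans (at e k)
    (≡.trans (+-at y _ k)
    (cong (Z._+_ (y k)) (≡.trans (+-at _ _ k)
      (≡.trans (cong₂ Z._+_ (const*-at c s k) (X^*-< n t k<n)) (ℤₚ.+-identityʳ _)))))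

  𝟙[_] : ∀ {P : Set} → Dec P → ℤ
  𝟙[ yes _ ] = 1ℤ
  𝟙[ no  _ ] = 0ℤ

  𝟙-yes : ∀ {P : Set} (P? : Dec P) → P → 𝟙[ P? ] ≡ 1ℤ
  𝟙-yes (yes _) _ = ≡.refl
  𝟙-yes (no ¬p) p = contradiction p ¬p

  𝟙-no : ∀ {P : Set} (P? : Dec P) → ¬ P → 𝟙[ P? ] ≡ 0ℤ
  𝟙-no (yes p) ¬p = contradiction p ¬p
  𝟙-no (no _)  _  = ≡.refl

  𝟙-cong : ∀ {P R : Set} (P? : Dec P) (R? : Dec R) → (P → R) → (R → P) → 𝟙[ P? ] ≡ 𝟙[ R? ]
  𝟙-cong (yes p) R? f g = ≡.sym (𝟙-yes R? (f p))
  𝟙-cong (no ¬p) R? f g = ≡.sym (𝟙-no R? (λ r → ¬p (g r)))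

  -- 1/(1 − X^(m+1))
  geom : ℕ → Series
  geom m n = 𝟙[ suc m ∣? n ]

  geom-inverse : ∀ m → geom m * (1# + - X ^ suc m) ≈ 1#
  geom-inverse m = trans
    (solve 2 (λ g x → g :* (one :- x) := g :+ :- (x :* g)) refl (geom m) (X ^ suc m))
    (coeffwise λ k → ≡.trans (+-at _ _ k) (≡.trans (cong (Z._+_ (geom m k)) (-‿at _ k))
      (low-or-shifted (suc m) (λ k → geom m k Z.+ Z.- (X ^ suc m * geom m) k ≡ 1# k) low high k)))
    where
    open Solver using (solve; _:+_; _:*_; _:-_; :-_; _:=_)
    low : ∀ k → k < suc m → geom m k Z.+ Z.- (X ^ suc m * geom m) k ≡ 1# k
    low zero    k<m = cong₂ (λ a b → a Z.+ Z.- b) (𝟙-yes (suc m ∣? 0) (_ ∣0))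
      (X^*-< (suc m) (geom m) k<m)
    low (suc k) k<m = cong₂ (λ a b → a Z.+ Z.- b) (𝟙-no (suc m ∣? suc k) (>⇒∤ k<m))
      (X^*-< (suc m) (geom m) k<m)
    high : ∀ k → geom m (suc m ℕ.+ k) Z.+ Z.- (X ^ suc m * geom m) (suc m ℕ.+ k) ≡ 0ℤ
    high k = ≡.trans (cong₂ (λ a b → a Z.+ Z.- b)
        (𝟙-cong (suc m ∣? suc m ℕ.+ k) (suc m ∣? k) (λ d → ∣m+n∣m⇒∣n d ∣-refl) (∣m∣n⇒∣m+n ∣-refl))
        (X^*-+ (suc m) (geom m) k))
      (ℤₚ.+-inverseʳ (geom m k))

  x : ℕ → Series
  x k = X ^ suc k

  -- 1/(1 + X^(k+1)) = (1 − X^(k+1))/(1 − X^(2k+2))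
  r : ℕ → Series
  r k = (1# + - x k) * geom (k ℕ.+ suc k)

  r-inverse : ∀ k → r k * (1# + x k) ≈ 1#
  r-inverse k =
    (linear 1# (geom-inverse (k ℕ.+ suc k))
    (linear g (^-+ X (suc k) (suc k))
    (solve 3 (λ a b g →
        (one :- a) :* g :* (one :+ a)
        :+ one :* one
        :+ g :* (a :* a)
      := one
        :+ one :* (g :* (one :- b))
        :+ g :* b)
      refl a b g)))
    where
    open Solver
    a = x k
    b = X ^ (suc k ℕ.+ suc k)
    g = geom (k ℕ.+ suc k)

  module Φ (x r : ℕ → Series) (r-inverse : ∀ k → r k * (1# + x k) ≈ 1#) where

    -- Each factor is (1 - x)/(1 + x) = 1 - 2x/(1 + x), so `S` can be built up without dividing by
    -- 2. The sequence `x` is a parameter because φ(-q) and φ(-q²) both occur.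
    Φ S : ℕ → Series
    Φ zero    = 1#
    Φ (suc k) = Φ k * ((1# + - x k) * r k)
    S zero    = 0#
    S (suc k) = S k + - (x k * r k * (1# + const (+ 2) * S k))

    Φ≈1+2S : ∀ k → Φ k ≈ 1# + const (+ 2) * S k
    Φ≈1+2S zero    = solve 0 (one := one :+ con (+ 2) :* nil) refl
      where open Solver
    Φ≈1+2S (suc k) =
      (linear ((1# + - y) * r0) (Φ≈1+2S k)
      (linear (1# + const (+ 2) * s) (r-inverse k)
      (solve 4 (λ f r0 s y →
          f :* ((one :- y) :* r0)
          :+ (one :- y) :* r0 :* (one :+ con (+ 2) :* s)
          :+ (one :+ con (+ 2) :* s) :* one
        := one :+ con (+ 2) :* (s :- y :* r0 :* (one :+ con (+ 2) :* s))
          :+ (one :- y) :* r0 :* f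
          :+ (one :+ con (+ 2) :* s) :* (r0 :* (one :+ y)))
        refl f r0 s y)))
      where
      open Solver
      f = Φ k
      y = x k
      r0 = r k
      s = S k

    -- Squaring `S` for φ(-q) cut after 2n factors gives `S` for φ(-q²) cut after 2n factors, while
    -- the product identity involves only n of these.
    S-tail : ∀ {m} (z : ℕ → Series) n → (∀ j → x (j ℕ.+ n) ≈ m * z j) → ∀ j →
      Cong 0ℤ m (S (j ℕ.+ n)) (S n)
    S-tail         z n e zero    = mod-refl
    S-tail {m = m} z n e (suc j) = mod-trans (mod-+ (S-tail z n e j)
        (mod-witness 0# (- (z j * r0 * (1# + const (+ 2) * s)))
      (linear (- (r0 * (1# + const (+ 2) * s))) (e j)
      (solve 5 (λ m r0 s y zj →
          (:- (y :* r0 :* (one :+ con (+ 2) :* s)))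
          :+ (:- (r0 :* (one :+ con (+ 2) :* s))) :* (m :* zj)
        := nil :+ (nil :* nil :+ m :* (:- (zj :* r0 :* (one :+ con (+ 2) :* s))))
          :+ (:- (r0 :* (one :+ con (+ 2) :* s))) :* y)
        refl m r0 s y zj))
        )) (≈⇒mod (+-identityʳ _))
      where
      open Solver
      y = x (j ℕ.+ n)
      r0 = r (j ℕ.+ n)
      s = S (j ℕ.+ n)
      zj = z j

  module Φ² (x r r₂ : ℕ → Series) (r-inverse : ∀ k → r k * (1# + x k) ≈ 1#)
    (r₂-inverse : ∀ k → r₂ k * (1# + x k * x k) ≈ 1#) where

    private
      module A = Φ x r r-inverse
      module B = Φ (λ k → x k * x k) r₂ r₂-inverse

    -- Modulo 2 both S are sums, of x/(1+x) and of x²/(1+x²), and (x/(1+x))² ≡ x²/(1+x²).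
    S²≡S₂ : ∀ {m} k → Cong (+ 2) m (A.S k * A.S k) (B.S k)
    S²≡S₂ zero    = ≈⇒mod (zeroˡ _)
    S²≡S₂ (suc k) = mod-witness
      (c + (const (+ 2) * s * s * a * a + - (s * a) + - (const (+ 2) * s * s * a) + const
        (+ 2) * s * a * a + s2 * b + b + - (y * y * y * r0 * r0 * r2))) ct
      (linear 1# C.eq
      (linear (- (y * y * r0 * r0)) (r₂-inverse k)
      (linear (y * y * r2 * (r0 * (1# + y) + 1#)) (r-inverse k)
      (solve 8 (λ c ct m r0 r2 s s2 y →
          (s :- y :* r0 :* (one :+ con (+ 2) :* s)) :* (s :- y :* r0 :* (one :+ con (+ 2) :* s))
          :+ one :* (s2 :+ (con (+ 2) :* c :+ m :* ct))
          :+ (:- (y :* y :* r0 :* r0)) :* one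
          :+ y :* y :* r2 :* (r0 :* (one :+ y) :+ one) :* one
        := s2 :- y :* y :* r2 :* (one :+ con (+ 2) :* s2) :+
          (con (+ 2) :* (c :+ (con (+ 2) :* s :* s :* (y :* r0) :* (y :* r0) :- s :* (y :* r0) :-
            con (+ 2) :* s :* s :* (y :* r0) :+ con (+ 2) :* s :* (y :* r0) :* (y :* r0) :+
              s2 :* (y :* y :* r2) :+ y :* y :* r2 :- y :* y :* y :* r0 :* r0 :* r2)) :+ m :* ct)
          :+ one :* (s :* s)
          :+ (:- (y :* y :* r0 :* r0)) :* (r2 :* (one :+ y :* y))
          :+ y :* y :* r2 :* (r0 :* (one :+ y) :+ one) :* (r0 :* (one :+ y)))
        refl c ct m r0 r2 s s2 y))))
      where
      open Solver
      module C = Cong (S²≡S₂ k)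
      m = _
      s = A.S k
      s2 = B.S k
      y = x k
      r0 = r k
      r2 = r₂ k
      a = y * r0
      b = y * y * r2
      c = C.s
      ct = C.t

  module G⁺ where
    open Products X public
    o w : ℕ → Series
    o n = geom (n ℕ.+ n)
    w n = geom (suc (n ℕ.+ n))

    o-inverse : ∀ n → o n * (1# + - odd n) ≈ 1#
    o-inverse n = trans (*-congˡ (+-congˡ (-‿cong (odd≈^ n)))) (geom-inverse (n ℕ.+ n))

    w-inverse : ∀ n → w n * (1# + - Q ^ suc n) ≈ 1#
    w-inverse n = trans (*-congˡ (+-congˡ (-‿cong (Q^≈^ n)))) (geom-inverse (suc (n ℕ.+ n)))

    open Gauss o w o-inverse w-inverse public

  -- ((−1)^n − 1)/2
  ε : ℕ → ℤ
  ε zero    = 0ℤ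
  ε (suc n) = Z.- (1ℤ Z.+ ε n)

  -X^ : ∀ n → (- X) ^ n ≈ X ^ n + const (+ 2) * (const (ε n) * X ^ n)
  -X^ zero    = solve 0 (one := one :+ con (+ 2) :* (nil :* one)) refl
    where open Solver
  -X^ (suc n) =
    (linear (- y) (-X^ n)
    (linear (- (const (+ 2) * y * z)) ε-suc
    (solve 5 (λ e e1 y z z1 →
        (:- y) :* z1
        :+ (:- y) :* (z :+ con (+ 2) :* (e :* z))
        :+ (:- (con (+ 2) :* y :* z)) :* (:- (one :+ e))
      := y :* z :+ con (+ 2) :* (e1 :* (y :* z))
        :+ (:- y) :* z1
        :+ (:- (con (+ 2) :* y :* z)) :* e1)
      refl e e1 y z z1)))
    where
    open Solver
    y = X
    z = X ^ n
    z1 = (- X) ^ n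
    e = const (ε n)
    e1 = const (ε (suc n))
    ε-suc : e1 ≈ - (1# + e)
    ε-suc = trans (const-neg (1ℤ Z.+ ε n)) (-‿cong (const-+ 1ℤ (ε n)))

  module G⁻ where
    open Products (- X) public
    -- At `- X` only the odd powers change sign: 1 - q^(2n+1) becomes 1 + X^(2n+1), whose inverse is
    -- an `r`.
    o w : ℕ → Series
    o n = r (n ℕ.+ n)
    w n = geom (suc (n ℕ.+ n))

    odd≈- : ∀ n → odd n ≈ - x (n ℕ.+ n)
    odd≈- zero    = -‿cong (sym (*-identityʳ _))
    odd≈- (suc n) rewrite ℕₚ.+-suc n n = trans (*-congˡ (odd≈- n))
      (solve 2 (λ y z → (:- y) :* (:- y) :* (:- z) := :- (y :* (y :* z))) refl X (x (n ℕ.+ n)))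
      where open Solver

    Q^≈x : ∀ n → Q ^ suc n ≈ x (suc (n ℕ.+ n))
    Q^≈x zero    = solve 1 (λ y → (:- y) :* (:- y) :* one := y :* (y :* one)) refl X
      where open Solver
    Q^≈x (suc n) rewrite ℕₚ.+-suc n n = trans (*-congˡ (Q^≈x n))
      (solve 2 (λ y z → (:- y) :* (:- y) :* z := y :* (y :* z)) refl X (x (suc (n ℕ.+ n))))
      where open Solver

    o-inverse : ∀ n → o n * (1# + - odd n) ≈ 1#
    o-inverse n =
      (linear (- o0) (odd≈- n)
      (linear 1# (r-inverse (n ℕ.+ n))
      (solve 3 (λ d o0 y →
          o0 :* (one :- d)
          :+ (:- o0) :* (:- y)
          :+ one :* one
        := one
          :+ (:- o0) :* d
          :+ one :* (o0 :* (one :+ y)))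
        refl d o0 y)))
      where
      open Solver
      o0 = o n
      d = odd n
      y = x (n ℕ.+ n)

    w-inverse : ∀ n → w n * (1# + - Q ^ suc n) ≈ 1#
    w-inverse n = trans (*-congˡ (+-congˡ (-‿cong (Q^≈x n)))) (geom-inverse (suc (n ℕ.+ n)))

    open Gauss o w o-inverse w-inverse public

  square : ∀ k → x k * x k ≈ x (suc (k ℕ.+ k))
  square k = trans (sym (^-+ X (suc k) (suc k))) (reflexive (cong (λ j → X ^ suc j) (ℕₚ.+-suc k k)))

  r₂ : ℕ → Series
  r₂ k = r (suc (k ℕ.+ k))

  r₂-inverse : ∀ k → r₂ k * (1# + x k * x k) ≈ 1#
  r₂-inverse k = trans (*-congˡ (+-congˡ (square k))) (r-inverse (suc (k ℕ.+ k)))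

  module Φ₁ = Φ x r r-inverse
  module Φ₂ = Φ (λ k → x k * x k) r₂ r₂-inverse

  -- Two consecutive factors of φ(-q), those of X^(2k+1) and X^(2k+2), go with one factor of each
  -- other product, hence n + n. In each such block 1 - X^(2k+1) cancels and the remaining factors
  -- regroup.
  Φ₁Π≈Π⁻Φ₂ : ∀ n → Φ₁.Φ (n ℕ.+ n) * G⁺.Π n ≈ G⁻.Π n * Φ₂.Φ n
  Φ₁Π≈Π⁻Φ₂ zero    = refl
  Φ₁Π≈Π⁻Φ₂ (suc n) = trans (*-congʳ (reflexive (cong (λ j → Φ₁.Φ (suc j)) (ℕₚ.+-suc n n))))
    (
    (linear (r0 * r1 * (1# + - z1) * (1# + - z2)) (Φ₁Π≈Π⁻Φ₂ n)
    (linear (f * c * r0 * r1 * (1# + - z1) * (1# + - z2)) (G⁺.o-inverse n)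
    (linear (f * c * r0 * r1 * (1# + - z1) * (1# + - z2) * o) (G⁺.odd≈^ n)
    (linear (- (cm * f2 * r0 * r1 * (1# + - z1))) (G⁺.Q^≈^ n)
    (linear (cm * f2 * r0 * r1 * (1# + - z4)) (G⁻.Q^≈x n)
    (linear (cm * f2 * r0 * r1 * (1# + - z1)) (square n)
    (solve 13 (λ c cm d f f2 o r0 r1 y z1 z2 z3 z4 →
        f :* ((one :- y) :* r0) :* ((one :- z1) :* r1) :* (c :* ((one :- z2) :* o))
        :+ r0 :* r1 :* (one :- z1) :* (one :- z2) :* (cm :* f2)
        :+ f :* c :* r0 :* r1 :* (one :- z1) :* (one :- z2) :* one
        :+ f :* c :* r0 :* r1 :* (one :- z1) :* (one :- z2) :* o :* y
        :+ (:- (cm :* f2 :* r0 :* r1 :* (one :- z1))) :* z1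
        :+ cm :* f2 :* r0 :* r1 :* (one :- z4) :* z1
        :+ cm :* f2 :* r0 :* r1 :* (one :- z1) :* z1
      := cm :* ((one :- z3) :* r0) :* (f2 :* ((one :- z4) :* r1))
        :+ r0 :* r1 :* (one :- z1) :* (one :- z2) :* (f :* c)
        :+ f :* c :* r0 :* r1 :* (one :- z1) :* (one :- z2) :* (o :* (one :- d))
        :+ f :* c :* r0 :* r1 :* (one :- z1) :* (one :- z2) :* o :* d
        :+ (:- (cm :* f2 :* r0 :* r1 :* (one :- z1))) :* z2
        :+ cm :* f2 :* r0 :* r1 :* (one :- z4) :* z3
        :+ cm :* f2 :* r0 :* r1 :* (one :- z1) :* z4)
      refl c cm d f f2 o r0 r1 y z1 z2 z3 z4)))))))
    )
    where
    open Solver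
    f = Φ₁.Φ (n ℕ.+ n)
    c = G⁺.Π n
    cm = G⁻.Π n
    f2 = Φ₂.Φ n
    y = x (n ℕ.+ n)
    d = G⁺.odd n
    o = G⁺.o n
    r0 = r (n ℕ.+ n)
    r1 = r (suc (n ℕ.+ n))
    z1 = x (suc (n ℕ.+ n))
    z2 = G⁺.Q ^ suc n
    z3 = G⁻.Q ^ suc n
    z4 = x n * x n

  pedSeries : ℕ → Series
  pedSeries zero    = 1#
  pedSeries (suc n) = pedSeries n * ((1# + x (suc (n ℕ.+ n))) * geom (n ℕ.+ n))

  ped*Φ₂≈Π : ∀ n → pedSeries n * Φ₂.Φ n ≈ G⁺.Π n
  ped*Φ₂≈Π zero    = *-identityˡ _
  ped*Φ₂≈Π (suc n) =
    (linear ((1# + z1) * o * (1# + - z4) * r1) (ped*Φ₂≈Π n)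
    (linear (c * o * (1# + - z4)) (r-inverse (suc (n ℕ.+ n)))
    (linear (- (c * o)) (square n)
    (linear (c * o) (G⁺.Q^≈^ n)
    (solve 8 (λ c f2 o p r1 z1 z2 z4 →
        p :* ((one :+ z1) :* o) :* (f2 :* ((one :- z4) :* r1))
        :+ (one :+ z1) :* o :* (one :- z4) :* r1 :* c
        :+ c :* o :* (one :- z4) :* one
        :+ (:- (c :* o)) :* z1
        :+ c :* o :* z1
      := c :* ((one :- z2) :* o)
        :+ (one :+ z1) :* o :* (one :- z4) :* r1 :* (p :* f2)
        :+ c :* o :* (one :- z4) :* (r1 :* (one :+ z1))
        :+ (:- (c :* o)) :* z4
        :+ c :* o :* z2)
      refl c f2 o p r1 z1 z2 z4)))))
    where
    open Solver
    p = pedSeries n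
    f2 = Φ₂.Φ n
    c = G⁺.Π n
    o = geom (n ℕ.+ n)
    r1 = r (suc (n ℕ.+ n))
    z1 = x (suc (n ℕ.+ n))
    z2 = G⁺.Q ^ suc n
    z4 = x n * x n

  T₁ T₂ : ℕ → ℕ
  T₁ n = n ℕ.* suc (n ℕ.+ n)
  T₂ n = suc n ℕ.* suc (n ℕ.+ n)

  -- `D` truncates (ψ(-q) - ψ(q))/2, and `E` is its square without the cross terms, which are even.
  D E : ℕ → Series
  D zero    = 0#
  D (suc n) = D n + (const (ε (T₁ n)) * X ^ T₁ n + const (ε (T₂ n)) * X ^ T₂ n)
  E zero    = 0#
  E (suc n) = E n + (const (ε (T₁ n) Z.* ε (T₁ n)) * X ^ (T₁ n ℕ.+ T₁ n) + const
    (ε (T₂ n) Z.* ε (T₂ n)) * X ^ (T₂ n ℕ.+ T₂ n))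

  triangular-sum-neg : ∀ n → G⁻.triangular-sum n ≈ G⁺.triangular-sum n + const (+ 2) * D n
  triangular-sum-neg zero    = solve 0 (nil := nil :+ con (+ 2) :* nil) refl
    where open Solver
  triangular-sum-neg (suc n) =
    (linear 1# (triangular-sum-neg n)
    (linear 1# (-X^ (T₁ n))
    (linear 1# (-X^ (T₂ n))
    (solve 9 (λ d e1 e2 tm tp y1 y2 z1 z2 →
        tm :+ (y1 :+ y2)
        :+ one :* (tp :+ con (+ 2) :* d)
        :+ one :* (z1 :+ con (+ 2) :* e1)
        :+ one :* (z2 :+ con (+ 2) :* e2)
      := tp :+ (z1 :+ z2) :+ con (+ 2) :* (d :+ (e1 :+ e2))
        :+ one :* tm
        :+ one :* y1
        :+ one :* y2)
      refl d e1 e2 tm tp y1 y2 z1 z2))))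
    where
    open Solver
    tm = G⁻.triangular-sum n
    tp = G⁺.triangular-sum n
    y1 = (- X) ^ T₁ n
    y2 = (- X) ^ T₂ n
    z1 = X ^ T₁ n
    z2 = X ^ T₂ n
    d = D n
    e1 = const (ε (T₁ n)) * z1
    e2 = const (ε (T₂ n)) * z2

  D²≡E : ∀ {m} n → Cong (+ 2) m (D n * D n) (E n)
  D²≡E zero    = ≈⇒mod (zeroˡ _)
  D²≡E (suc n) = mod-witness (c + (d * (a1 * z1) + d * (a2 * z2) + a1 * z1 * (a2 * z2))) ct
    (linear 1# C.eq
    (linear (- b1) (^-+ X (T₁ n) (T₁ n))
    (linear (- b2) (^-+ X (T₂ n) (T₂ n))
    (linear (- (z1 * z1)) (const-* (ε (T₁ n)) (ε (T₁ n)))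
    (linear (- (z2 * z2)) (const-* (ε (T₂ n)) (ε (T₂ n)))
    (solve 13 (λ a1 a2 b1 b2 c ct d e m y1 y2 z1 z2 →
        (d :+ (a1 :* z1 :+ a2 :* z2)) :* (d :+ (a1 :* z1 :+ a2 :* z2))
        :+ one :* (e :+ (con (+ 2) :* c :+ m :* ct))
        :+ (:- b1) :* (z1 :* z1)
        :+ (:- b2) :* (z2 :* z2)
        :+ (:- (z1 :* z1)) :* (a1 :* a1)
        :+ (:- (z2 :* z2)) :* (a2 :* a2)
      := e :+ (b1 :* y1 :+ b2 :* y2) :+
        (con (+ 2) :* (c :+ (d :* (a1 :* z1) :+ d :* (a2 :* z2) :+ a1 :* z1 :* (a2 :* z2))) :+
          m :* ct)
        :+ one :* (d :* d)
        :+ (:- b1) :* y1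
        :+ (:- b2) :* y2
        :+ (:- (z1 :* z1)) :* b1
        :+ (:- (z2 :* z2)) :* b2)
      refl a1 a2 b1 b2 c ct d e m y1 y2 z1 z2))))))
    where
    open Solver
    module C = Cong (D²≡E n)
    m = _
    c = C.s
    ct = C.t
    d = D n
    e = E n
    a1 = const (ε (T₁ n))
    a2 = const (ε (T₂ n))
    b1 = const (ε (T₁ n) Z.* ε (T₁ n))
    b2 = const (ε (T₂ n) Z.* ε (T₂ n))
    z1 = X ^ T₁ n
    z2 = X ^ T₂ n
    y1 = X ^ (T₁ n ℕ.+ T₁ n)
    y2 = X ^ (T₂ n ℕ.+ T₂ n)

  -- The squared generating series modulo 8 and X^n.

  module _ (k : ℕ) where
    private
      n = suc k
      c = pedSeries n
      p = G⁺.Π n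
      pm = G⁻.Π n
      d = D n
      e = E n
      s1 = Φ₁.S (n ℕ.+ n)
      s2 = Φ₂.S n

      x-split : ∀ j → x (j ℕ.+ n) * x (j ℕ.+ n) ≈ X ^ n * (X * X ^ j * x (j ℕ.+ n))
      x-split j = trans (*-congʳ (*-congˡ (^-+ X j n)))
        (solve 4 (λ X a b y → X :* (a :* b) :* y := b :* (X :* a :* y)) refl X (X ^ j) (X ^ n)
          (x (j ℕ.+ n)))
        where open Solver

      X^-split : X ^ suc (n ℕ.+ n) ≈ X ^ n * X ^ suc n
      X^-split = trans (reflexive (cong (X ^_) (≡.sym (ℕₚ.+-suc n n)))) (^-+ X n (suc n))

      Θ⁺ : Cong 0ℤ (X ^ n) p (G⁺.triangular-sum n)
      Θ⁺ = mod-sym (mod-trans (≈⇒mod (sym (G⁺.Θ≈ n)))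
        (mod-weaken (X ^ suc n) (trans (G⁺.odd≈^ n) X^-split) (G⁺.Θ≡Π k)))

      Θ⁻ : Cong 0ℤ (X ^ n) pm (G⁻.triangular-sum n)
      Θ⁻ = mod-sym (mod-trans (≈⇒mod (sym (G⁻.Θ≈ n)))
        (mod-weaken (- X ^ suc n) (trans (G⁻.odd≈- n) (trans (-‿cong X^-split)
          (solve 2 (λ a b → :- (a :* b) := a :* (:- b)) refl (X ^ n) (X ^ suc n)))) (G⁻.Θ≡Π k)))
        where open Solver

      Π⁻≡Π+2D : Cong 0ℤ (X ^ n) pm (p + const (+ 2) * d)
      Π⁻≡Π+2D = mod-trans Θ⁻ (mod-trans (≈⇒mod (triangular-sum-neg n))
        (mod-+ (mod-sym Θ⁺) mod-refl))

      -- The integer modulus remains 0 because a factor 2 is divided out next; reduced modulo 2 the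
      -- congruence would be trivial.
      2Y≡0 : Cong 0ℤ (X ^ n) ((1# + const (+ 2) * s1) * p)
        ((p + const (+ 2) * d) * (1# + const (+ 2) * s2))
      2Y≡0 = mod-trans (≈⇒mod
        (linear 1# (Φ₁Π≈Π⁻Φ₂ n)
        (linear (- p) (Φ₁.Φ≈1+2S (n ℕ.+ n))
        (linear pm (Φ₂.Φ≈1+2S n)
        (solve 6 (λ f1 f2 p pm s1 s2 →
            (one :+ con (+ 2) :* s1) :* p
            :+ one :* (pm :* f2)
            :+ (:- p) :* (one :+ con (+ 2) :* s1)
            :+ pm :* (one :+ con (+ 2) :* s2)
          := pm :* (one :+ con (+ 2) :* s2)
            :+ one :* (f1 :* p)
            :+ (:- p) :* f1
            :+ pm :* f2)
          refl f1 f2 p pm s1 s2))))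
        ) (mod-* Π⁻≡Π+2D mod-refl)
        where
        open Solver
        f1 = Φ₁.Φ (n ℕ.+ n)
        f2 = Φ₂.Φ n

      -- Half of `2Y≡0`, namely p s1 - p s2 - d - 2 d s2 ≡ 0; modulo 2 the sign of p s2 is
      -- immaterial and the last term disappears.
      Π[S₁+S₂]≡D : Cong (+ 2) (X ^ n) (p * (s1 + s2)) d
      Π[S₁+S₂]≡D = mod-witness (d * s2 + p * s2) y
        (linear 1# e′
        (solve 6 (λ d m p s1 s2 y →
            p :* (s1 :+ s2)
            :+ one :* (m :* y)
          := d :+ (con (+ 2) :* (d :* s2 :+ p :* s2) :+ m :* y)
            :+ one :* (s1 :* p :- s2 :* p :- d :- con (+ 2) :* d :* s2))
          refl d m p s1 s2 y))
        where
        open Solver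
        module Y = Cong 2Y≡0
        m = X ^ n
        half = halve n (s1 * p + - (s2 * p) + - d + - (const (+ 2) * d * s2)) Y.t
          (linear 1# Y.eq
          (solve 7 (λ d m p s1 s2 ys yt →
              con (+ 2) :* (s1 :* p :- s2 :* p :- d :- con (+ 2) :* d :* s2)
              :+ one :* ((p :+ con (+ 2) :* d) :* (one :+ con (+ 2) :* s2) :+
                (nil :* ys :+ m :* yt))
            := m :* yt
              :+ one :* ((one :+ con (+ 2) :* s1) :* p))
            refl d m p s1 s2 Y.s Y.t))
        y = proj₁ half
        e′ = proj₂ half

      S₁²≡S₂ : Cong (+ 2) (X ^ n) (s1 * s1) s2
      S₁²≡S₂ = mod-trans (Φ².S²≡S₂ x r r₂ r-inverse r₂-inverse (n ℕ.+ n))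
        (mod-weaken 1# (sym (*-identityʳ _)) (Φ₂.S-tail (λ j → X * X ^ j * x (j ℕ.+ n)) n x-split
          n))

      -- Modulo 2, s2 + s2² ≡ s1² + s2² ≡ (s1 + s2)², so the left side is the square of
      -- `p * (s1 + s2)`, hence of `d`.
      Π²W≡E : Cong (+ 2) (X ^ n) (p * p * (s2 + s2 * s2)) e
      Π²W≡E = mod-trans
        (mod-* mod-refl (mod-+ (mod-sym S₁²≡S₂) mod-refl))
        (mod-trans (mod-witness (- (p * p * s1 * s2)) 0#
          (solve 4 (λ m p s1 s2 →
              p :* p :* (s1 :* s1 :+ s2 :* s2)
            := p :* (s1 :+ s2) :* (p :* (s1 :+ s2)) :+
              (con (+ 2) :* (:- (p :* p :* s1 :* s2)) :+ m :* nil))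
            refl m p s1 s2)
          ) (mod-trans (mod-sq Π[S₁+S₂]≡D) (D²≡E n)))
        where
        open Solver
        m = X ^ n

    -- With w = s2 + s2², (1 + 2 s2)² = 1 + 4w is its own inverse modulo 8, so division by φ(-q²)²
    -- becomes multiplication by 1 + 4w. The factor 4 makes it enough to know p² w modulo 2.
    ped²≡Λ+4E : Cong (+ 8) (X ^ n) (c * c) (G⁺.Λ n + const (+ 4) * e)
    ped²≡Λ+4E = mod-trans (mod-witness (- (c * c * (w + const (+ 2) * w * w))) 0#
        (linear (- (c * c * (1# + const (+ 4) * (s + s * s)) * (f + 1# + const (+ 2) * s)))
          (Φ₂.Φ≈1+2S n)
        (linear ((1# + const (+ 4) * (s + s * s)) * (c * f + p)) (ped*Φ₂≈Π n)
        (solve 5 (λ c f m p s →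
            c :* c
            :+ (:- (c :* c :* (one :+ con (+ 4) :* (s :+ s :* s)) :* (f :+ one :+ con (+ 2) :* s)))
              :* (one :+ con (+ 2) :* s)
            :+ (one :+ con (+ 4) :* (s :+ s :* s)) :* (c :* f :+ p) :* p
          := p :* p :+ con (+ 4) :* (p :* p :* (s :+ s :* s)) :+
            (con (+ 8) :* (:- (c :* c :* (s :+ s :* s :+ con
              (+ 2) :* (s :+ s :* s) :* (s :+ s :* s)))) :+ m :* nil)
            :+ (:- (c :* c :* (one :+ con (+ 4) :* (s :+ s :* s)) :* (f :+ one :+ con (+ 2) :* s)))
              :* f
            :+ (one :+ con (+ 4) :* (s :+ s :* s)) :* (c :* f :+ p) :* (c :* f))
          refl c f m p s)))
        )
      (mod-trans (mod-+ (mod-weaken 1# (sym (*-identityʳ _)) Π²≡Λ′) mod-refl)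
        (mod-+ mod-refl (mod-witness C.s (const (+ 4) * C.t)
          (linear (const (+ 4)) C.eq
          (solve 5 (λ cs ct e m z →
              con (+ 4) :* z
              :+ con (+ 4) :* (e :+ (con (+ 2) :* cs :+ m :* ct))
            := con (+ 4) :* e :+ (con (+ 8) :* cs :+ m :* (con (+ 4) :* ct))
              :+ con (+ 4) :* z)
            refl C.s C.t e m z))
          )))
      where
      open Solver
      module C = Cong Π²W≡E
      m = X ^ n
      f = Φ₂.Φ n
      s = s2
      w = s2 + s2 * s2
      z = p * p * w
      Π²≡Λ′ : Cong 0ℤ (X ^ n) (p * p) (G⁺.Λ n)
      Π²≡Λ′ = mod-weaken (X ^ n) (*-^ X X n) (G⁺.Π²≡Λ k)

-- Counting bipartitions by the generating series.

module PartitionCount where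

  open import Defs
  open import Data.List.Base
    using (List; []; _∷_; _++_; map; filter; length; concatMap; cartesianProduct; applyUpTo)
  open import Data.List.Properties using
    (length-map; length-++; filter-all; filter-accept; filter-reject; ∷-injectiveʳ)
  open import Data.List.Membership.Propositional using (_∈_)
  open import Data.List.Membership.Propositional.Properties
    using (∈-filter⁺; ∈-filter⁻; ∈-++⁺ˡ; ∈-++⁺ʳ; ∈-++⁻; ∈-map⁺; ∈-map⁻)
  open import Data.List.Membership.Propositional.Properties.WithK using (unique∧set⇒bag)
  open import Data.List.Relation.Binary.BagAndSetEquality using (∼bag⇒↭)
  open import Data.List.Relation.Binary.Permutation.Propositional.Properties using (↭-length)
  open import Data.List.Relation.Unary.All as All using (All; []; _∷_; all?)
  import Data.List.Relation.Unary.All.Properties as All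
  open import Data.List.Relation.Unary.AllPairs using ([]; _∷_)
  open import Data.List.Relation.Unary.Linked as Linked using (Linked; []; [-]; _∷_)
  import Data.List.Relation.Unary.Linked.Properties as Linked
  open import Data.List.Relation.Unary.Unique.Propositional using (Unique)
  import Data.List.Relation.Unary.Unique.Propositional.Properties as Unique
  open import Data.Nat.Base using (_≥_)
  open import Data.Nat.ListAction using (sum)
  open import Data.Sum.Base using (inj₁; inj₂)
  open import Function.Base using (_∘_; id)
  open import Function.Bundles using (mk⇔; module Equivalence)
  open FormalSeries
  open Congruence
  open Theta
  open GeneratingFunction

  -- For lists without repetitions, equality as sets is equality as bags, hence a permutation; all
  -- counts below are thus compared through membership.
  equal-length : ∀ {A : Set} {xs ys : List A} → Unique xs → Unique ys →
    (∀ {z} → z ∈ xs → z ∈ ys) → (∀ {z} → z ∈ ys → z ∈ xs) → length xs ≡ length ys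
  equal-length xs! ys! f g = ↭-length (∼bag⇒↭ (unique∧set⇒bag xs! ys! (mk⇔ f g)))

  bounded : ℕ → ℕ → List (List ℕ)
  bounded m j = filter (all? (ℕₚ._≤? m)) (pedPartitions j)

  Bounded : ℕ → ℕ → List ℕ → Set
  Bounded m j xs = (IsPedPartition xs × sum xs ≡ j) × All (_≤ m) xs

  ∈-bounded⁻ : ∀ m j {xs} → xs ∈ bounded m j → Bounded m j xs
  ∈-bounded⁻ m j {xs} p with ∈-filter⁻ (all? (ℕₚ._≤? m)) {xs = pedPartitions j} p
  ... | q , b = Equivalence.to (∈-pedPartitions j xs) q , b

  ∈-bounded⁺ : ∀ m j {xs} → Bounded m j xs → xs ∈ bounded m j
  ∈-bounded⁺ m j {xs} (q , b) = ∈-filter⁺ (all? (ℕₚ._≤? m))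
    (Equivalence.from (∈-pedPartitions j xs) q) b

  bounded-unique : ∀ m j → Unique (bounded m j)
  bounded-unique m j = Unique.filter⁺ (all? (ℕₚ._≤? m)) (pedPartitions-unique j)

  pedPartition-tail : ∀ {x xs} → IsPedPartition (x ∷ xs) → IsPedPartition xs
  pedPartition-tail {x} {xs} ((l , _ ∷ pos) , d) = (Linked.tail l , pos) , distinct d
    where
    distinct : EvenPartsDistinct (x ∷ xs) → EvenPartsDistinct xs
    distinct d with 2 ∣? x
    ... | no  odd  = ≡.subst Unique (filter-reject (2 ∣?_) odd) d
    ... | yes even with ≡.subst Unique (filter-accept (2 ∣?_) even) d
    ...   | _ ∷ d′ = d′

  All-≤-pred : ∀ {m} {xs} → All (_≤ suc m) xs → All (suc m ≢_) xs → All (_≤ m) xs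
  All-≤-pred []       []       = []
  All-≤-pred (p ∷ ps) (n ∷ ns) = ℕₚ.≤-pred (ℕₚ.≤∧≢⇒< p (n ∘ ≡.sym)) ∷ All-≤-pred ps ns

  below-head : ∀ {x xs} → Linked _≥_ (x ∷ xs) → All (_≤ x) (x ∷ xs)
  below-head = Linked.Linked⇒All (λ p q → ℕₚ.≤-trans q p) ℕₚ.≤-refl

  linked-cons : ∀ {x xs} → All (_≤ x) xs → Linked _≥_ xs → Linked _≥_ (x ∷ xs)
  linked-cons []      []  = [-]
  linked-cons (p ∷ _) l   = p ∷ l

  parts≤sum : ∀ xs → All (_≤ sum xs) xs
  parts≤sum []       = []
  parts≤sum (x ∷ xs) = ℕₚ.m≤m+n x _ ∷ All.map (λ p → ℕₚ.≤-trans p (ℕₚ.m≤n+m _ x)) (parts≤sum xs)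

  private
    size : ℕ → ℕ → ℕ
    size m j = length (bounded m j)

  bounded-suc-< : ∀ m j → j < suc m → size (suc m) j ≡ size m j
  bounded-suc-< m j j<m = equal-length (bounded-unique (suc m) j) (bounded-unique m j)
    (λ p → let q , b = ∈-bounded⁻ (suc m) j p in ∈-bounded⁺ m j (q , small (proj₂ q) b))
    (λ p → let q , b = ∈-bounded⁻ m j p in ∈-bounded⁺ (suc m) j (q , All.map ℕₚ.m≤n⇒m≤1+n b))
    where
    small : ∀ {xs} → sum xs ≡ j → All (_≤ suc m) xs → All (_≤ m) xs
    small {xs} ≡.refl _ = All.map (λ p → ℕₚ.≤-trans p (ℕₚ.≤-pred j<m)) (parts≤sum xs)

  -- Removing the first part from the partitions with largest part m + 1 leaves
  -- the partitions with parts at most t.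
  bounded-suc-+ : ∀ m t k →
    (∀ {ys} → IsPedPartition (suc m ∷ ys) → All (_≤ t) ys) →
    (∀ {ys} → IsPedPartition ys → All (_≤ t) ys → IsPedPartition (suc m ∷ ys) × All (_≤ suc m) ys) →
    size (suc m) (suc m ℕ.+ k) ≡ size m (suc m ℕ.+ k) ℕ.+ size t k
  bounded-suc-+ m t k remove add = ≡.trans
    (equal-length (bounded-unique (suc m) j)
      (Unique.++⁺ (bounded-unique m j) (Unique.map⁺ ∷-injectiveʳ (bounded-unique t k)) disjoint)
      to from)
    (≡.trans (length-++ (bounded m j))
      (cong (length (bounded m j) ℕ.+_) (length-map _ (bounded t k))))
    where
    j = suc m ℕ.+ k
    tops = map (suc m ∷_) (bounded t k)
    disjoint : ∀ {v} → ¬ (v ∈ bounded m j × v ∈ tops)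
    disjoint (p , q) with ∈-map⁻ (suc m ∷_) q
    ... | _ , _ , ≡.refl with ∈-bounded⁻ m j p
    ...   | _ , b ∷ _ = ℕₚ.1+n≰n b
    to : ∀ {z} → z ∈ bounded (suc m) j → z ∈ bounded m j ++ tops
    to {z} p with ∈-bounded⁻ (suc m) j p
    to {[]}    p | q , b = ∈-++⁺ˡ (∈-bounded⁺ m j (q , []))
    to {y ∷ ys} p | (ped , e) , b ∷ bs with y ℕₚ.≟ suc m
    ... | yes ≡.refl = ∈-++⁺ʳ (bounded m j) (∈-map⁺ (suc m ∷_) (∈-bounded⁺ t k
                         ((pedPartition-tail ped , ℕₚ.+-cancelˡ-≡ (suc m) _ _ e) , remove ped)))
    ... | no y≢m = ∈-++⁺ˡ (∈-bounded⁺ m j ((ped , e) ,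
                     All.map (λ q → ℕₚ.≤-trans q (ℕₚ.≤-pred (ℕₚ.≤∧≢⇒< b y≢m)))
                       (below-head (proj₁ (proj₁ ped)))))
    from : ∀ {z} → z ∈ bounded m j ++ tops → z ∈ bounded (suc m) j
    from {z} p with ∈-++⁻ (bounded m j) p
    ... | inj₁ q = let r , b = ∈-bounded⁻ m j q in ∈-bounded⁺ (suc m) j (r , All.map ℕₚ.m≤n⇒m≤1+n b)
    ... | inj₂ q with ∈-map⁻ (suc m ∷_) q
    ...   | ys , ys∈ , ≡.refl =
      let (ped , e) , b = ∈-bounded⁻ t k ys∈
          ped′ , b′ = add ped b
      in ∈-bounded⁺ (suc m) j ((ped′ , cong (suc m ℕ.+_) e) , ℕₚ.≤-refl ∷ b′)

  -- An odd largest part may be repeated, so after one copy is removed m + 1 is still allowed.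
  bounded-odd : ∀ m k → ¬ 2 ∣ suc m →
    size (suc m) (suc m ℕ.+ k) ≡ size m (suc m ℕ.+ k) ℕ.+ size (suc m) k
  bounded-odd m k odd = bounded-suc-+ m (suc m) k
    (λ ped → All.tail (below-head (proj₁ (proj₁ ped))))
    (λ { ((l , pos) , d) b → ((linked-cons b l , s≤s z≤n ∷ pos) ,
           ≡.subst Unique (≡.sym (filter-reject (2 ∣?_) odd)) d) , b })

  -- An even largest part occurs once, so the remaining parts are at most m.
  bounded-even : ∀ m k → 2 ∣ suc m → size (suc m) (suc m ℕ.+ k) ≡ size m (suc m ℕ.+ k) ℕ.+ size m k
  bounded-even m k even = bounded-suc-+ m m k remove
    (λ { {ys} ((l , pos) , d) b → let b′ = All.map ℕₚ.m≤n⇒m≤1+n b in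
           ((linked-cons b′ l , s≤s z≤n ∷ pos) ,
            ≡.subst Unique (≡.sym (filter-accept (2 ∣?_) {xs = ys} even))
              (All.filter⁺ (2 ∣?_) (All.map (λ y≤m m≡y → ℕₚ.1+n≰n (≡.subst (_≤ m) (≡.sym m≡y) y≤m))
                b) ∷ d)) , b′ })
    where
    remove : ∀ {ys} → IsPedPartition (suc m ∷ ys) → All (_≤ m) ys
    remove {ys} ((l , _) , d) with ≡.subst Unique (filter-accept (2 ∣?_) {xs = ys} even) d
    ... | fresh ∷ _ = All-≤-pred (All.tail (below-head l)) (All.tabulate λ {y} y∈ m≡y →
            All.lookup fresh (∈-filter⁺ (2 ∣?_) y∈ (≡.subst (2 ∣_) m≡y even)) m≡y)

  sizes : ℕ → Series
  sizes m j = + size m j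

  sizes-0 : sizes 0 ≈ 1#
  sizes-0 = coeffwise λ { zero → ≡.refl ; (suc j) → cong +_
    (equal-length (bounded-unique 0 (suc j)) [] (none j) λ ()) }
    where
    none : ∀ j {z} → z ∈ bounded 0 (suc j) → z ∈ []
    none j p with ∈-bounded⁻ 0 (suc j) p
    none j {[]}    p | (_ , ()) , _
    none j {_ ∷ _} p | (((_ , s≤s _ ∷ _) , _) , _) , () ∷ _

  sizes-recurrence : ∀ m t →
    (∀ k → size (suc m) (suc m ℕ.+ k) ≡ size m (suc m ℕ.+ k) ℕ.+ size t k) →
    sizes (suc m) ≈ sizes m + X ^ suc m * sizes t
  sizes-recurrence m t rec = coeffwise λ j → ≡.trans
    (low-or-shifted (suc m) (λ j → sizes (suc m) j ≡ sizes m j Z.+ (X ^ suc m * sizes t) j)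
      (λ j j<m → ≡.trans (cong +_ (bounded-suc-< m j j<m))
        (≡.sym (≡.trans (cong (Z._+_ (sizes m j)) (X^*-< (suc m) (sizes t) j<m))
          (ℤₚ.+-identityʳ _))))
      (λ k → ≡.trans (cong +_ (rec k))
        (cong (Z._+_ (sizes m (suc m ℕ.+ k))) (≡.sym (X^*-+ (suc m) (sizes t) k)))) j)
    (≡.sym (+-at _ _ j))

  -- The bound grows by an odd and then an even part. The odd step has the unknown on both sides, (1
  -- - y) a1 = a0, and is solved by `geom`; the even step multiplies by 1 + z.
  sizes≈pedSeries : ∀ n → sizes (n ℕ.+ n) ≈ pedSeries n
  sizes≈pedSeries zero    = sizes-0
  sizes≈pedSeries (suc n) = trans (reflexive (cong (λ j → sizes (suc j)) (ℕₚ.+-suc n n)))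
    (
    (linear 1# even-step
    (linear ((1# + z) * g) odd-step
    (linear (- (a1 * (1# + z))) (geom-inverse m)
    (linear ((1# + z) * g) (sizes≈pedSeries n)
    (solve 7 (λ a0 a1 a2 g p y z →
        a2
        :+ one :* (a1 :+ z :* a1)
        :+ (one :+ z) :* g :* (a0 :+ y :* a1)
        :+ (:- (a1 :* (one :+ z))) :* one
        :+ (one :+ z) :* g :* p
      := p :* ((one :+ z) :* g)
        :+ one :* a2
        :+ (one :+ z) :* g :* a1
        :+ (:- (a1 :* (one :+ z))) :* (g :* (one :- y))
        :+ (one :+ z) :* g :* a0)
      refl a0 a1 a2 g p y z)))))
    )
    where
    open Solver
    m : ℕ
    m = n ℕ.+ n
    2∣m : 2 ∣ m
    2∣m = ≡.subst (2 ∣_) (cong (n ℕ.+_) (ℕₚ.+-identityʳ n)) (m∣m*n {2} n)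
    a0 = sizes m
    a1 = sizes (suc m)
    a2 = sizes (suc (suc m))
    y = x m
    z = x (suc m)
    g = geom m
    p = pedSeries n
    odd-step : a1 ≈ a0 + y * a1
    odd-step = sizes-recurrence m (suc m) λ k → bounded-odd m k λ d →
      contradiction (∣m+n∣m⇒∣n (≡.subst (2 ∣_) (ℕₚ.+-comm 1 m) d) 2∣m) (>⇒∤ (s≤s (s≤s z≤n)))
    even-step : a2 ≈ a1 + z * a1
    even-step = sizes-recurrence (suc m) (suc m) λ k → bounded-even (suc m) k (∣m∣n⇒∣m+n ∣-refl 2∣m)

  pedCount : Series
  pedCount j = + length (pedPartitions j)

  pedCount≡ : ∀ n k → k < n → pedCount k ≡ pedSeries n k
  pedCount≡ n k k<n = ≡.trans
    (cong (λ xs → + length xs) (≡.sym (filter-all (all? (ℕₚ._≤? n ℕ.+ n)) (All.tabulate small))))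
    (at (sizes≈pedSeries n) k)
    where
    small : ∀ {xs} → xs ∈ pedPartitions k → All (_≤ n ℕ.+ n) xs
    small {xs} p with Equivalence.to (∈-pedPartitions k xs) p
    ... | _ , ≡.refl = All.map (λ q → ℕₚ.≤-trans q (ℕₚ.≤-trans (ℕₚ.<⇒≤ k<n) (ℕₚ.m≤m+n n n)))
      (parts≤sum xs)

  length-cartesianProduct : ∀ {A B : Set} (xs : List A) (ys : List B) →
    length (cartesianProduct xs ys) ≡ length xs ℕ.* length ys
  length-cartesianProduct []       ys = ≡.refl
  length-cartesianProduct (x ∷ xs) ys = ≡.trans (length-++ (map (x ,_) ys))
    (cong₂ ℕ._+_ (length-map (x ,_) ys) (length-cartesianProduct xs ys))

  -- Stated for a general `h` because the induction turns `h` into `h ∘ suc` as `f` becomes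
  -- `tail f`.
  length-concatMap-conv : ∀ {A : Set} (F : ℕ → List A) (f g : Series) (h : ℕ → ℕ) n →
    (∀ i → i ≤ n → + length (F (h i)) ≡ f i Z.* g (n ℕ.∸ i)) →
    + length (concatMap F (applyUpTo h (suc n))) ≡ conv f g n
  length-concatMap-conv F f g h zero    e = ≡.trans
    (cong +_ (≡.trans (length-++ (F (h 0))) (ℕₚ.+-identityʳ _))) (e 0 z≤n)
  length-concatMap-conv F f g h (suc n) e = ≡.trans (cong +_ (length-++ (F (h 0))))
    (cong₂ Z._+_ (e 0 z≤n) (length-concatMap-conv F (tail f) g (h ∘ suc) n
      (λ i i≤n → e (suc i) (s≤s i≤n))))

  conv-cong-≤ : ∀ {f f′ g g′} n → (∀ i → i ≤ n → f i ≡ f′ i) → (∀ i → i ≤ n → g i ≡ g′ i) →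
    conv f g n ≡ conv f′ g′ n
  conv-cong-≤ zero    p q = cong₂ Z._*_ (p 0 z≤n) (q 0 z≤n)
  conv-cong-≤ (suc n) p q = cong₂ Z._+_ (cong₂ Z._*_ (p 0 z≤n) (q (suc n) ℕₚ.≤-refl))
    (conv-cong-≤ n (λ i i≤n → p (suc i) (s≤s i≤n)) (λ i i≤n → q i (ℕₚ.m≤n⇒m≤1+n i≤n)))

  ped₋₂≡ : ∀ n k → k < n → + ped₋₂ k ≡ (pedSeries n * pedSeries n) k
  ped₋₂≡ n k k<n = ≡.trans
    (length-concatMap-conv (pedBipartitionsAt k) pedCount pedCount id k λ i _ → ≡.trans
      (cong +_ (length-cartesianProduct (pedPartitions i) (pedPartitions (k ℕ.∸ i))))
        (ℤₚ.pos-* (length (pedPartitions i)) _))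
    (≡.trans (conv-cong-≤ k below below) (≡.sym (*-at _ _ k)))
    where
    below : ∀ i → i ≤ k → pedCount i ≡ pedSeries n i
    below i i≤k = pedCount≡ n i (ℕₚ.≤-<-trans i≤k k<n)

-- Divisor sums of the nontrivial character modulo 4.

module DivisorCharacterSum where

  open import Data.Nat.Coprimality using (Coprime; coprime-divisor)
  open import Data.Nat.Primality using (Prime; euclidsLemma; prime⇒irreducible; prime⇒nonZero)
  open import Data.Sum.Base using (_⊎_; inj₁; inj₂)
  open import Relation.Binary.Definitions using (tri<; tri≈; tri>)
  open GeneratingFunction using (𝟙[_]; 𝟙-yes; 𝟙-no; 𝟙-cong)
  open ≡ using (refl; sym; trans; subst)
  open ≡.≡-Reasoning

  Σ< : ℕ → (ℕ → ℤ) → ℤ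
  Σ< zero    f = 0ℤ
  Σ< (suc n) f = Σ< n f Z.+ f n

  Σ-cong : ∀ n {f g} → (∀ i → f i ≡ g i) → Σ< n f ≡ Σ< n g
  Σ-cong zero    e = refl
  Σ-cong (suc n) e = cong₂ Z._+_ (Σ-cong n e) (e n)

  Σ-zero : ∀ n {f} → (∀ i → i < n → f i ≡ 0ℤ) → Σ< n f ≡ 0ℤ
  Σ-zero zero    e = refl
  Σ-zero (suc n) e = cong₂ Z._+_ (Σ-zero n (λ i i<n → e i (ℕₚ.m<n⇒m<1+n i<n))) (e n ℕₚ.≤-refl)

  Σ-+ : ∀ n f g → Σ< n (λ i → f i Z.+ g i) ≡ Σ< n f Z.+ Σ< n g
  Σ-+ zero    f g = refl
  Σ-+ (suc n) f g = trans (cong (Z._+ (f n Z.+ g n)) (Σ-+ n f g))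
    (solve 4 (λ a b c d → (a :+ b) :+ (c :+ d) := (a :+ c) :+ (b :+ d)) refl (Σ< n f) (Σ< n g) (f n)
      (g n))
    where open ℤSolver.+-*-Solver

  Σ-* : ∀ n c f → Σ< n (λ i → c Z.* f i) ≡ c Z.* Σ< n f
  Σ-* zero    c f = sym (ℤₚ.*-zeroʳ c)
  Σ-* (suc n) c f = trans (cong (Z._+ (c Z.* f n)) (Σ-* n c f)) (sym (ℤₚ.*-distribˡ-+ c _ _))

  Σ-swap : ∀ m n (f : ℕ → ℕ → ℤ) → Σ< m (λ i → Σ< n (f i)) ≡ Σ< n (λ j → Σ< m (λ i → f i j))
  Σ-swap zero    n f = sym (Σ-zero n (λ _ _ → refl))
  Σ-swap (suc m) n f = trans (cong (Z._+ Σ< n (f m)) (Σ-swap m n f)) (sym (Σ-+ n _ (f m)))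

  Σ-split : ∀ m n f → Σ< (m ℕ.+ n) f ≡ Σ< m f Z.+ Σ< n (λ i → f (m ℕ.+ i))
  Σ-split m zero    f rewrite ℕₚ.+-identityʳ m = sym (ℤₚ.+-identityʳ _)
  Σ-split m (suc n) f rewrite ℕₚ.+-suc m n =
    trans (cong (Z._+ f (m ℕ.+ n)) (Σ-split m n f)) (ℤₚ.+-assoc (Σ< m f) _ (f (m ℕ.+ n)))

  Σ-extend : ∀ {m n} f → m ≤ n → (∀ i → m ≤ i → f i ≡ 0ℤ) → Σ< n f ≡ Σ< m f
  Σ-extend {m} {n} f m≤n e = begin
    Σ< n f                                         ≡⟨ cong (λ k → Σ< k f) (sym (ℕₚ.m+[n∸m]≡n m≤n)) ⟩
    Σ< (m ℕ.+ (n ℕ.∸ m)) f                         ≡⟨ Σ-split m (n ℕ.∸ m) f ⟩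
    Σ< m f Z.+ Σ< (n ℕ.∸ m) (λ i → f (m ℕ.+ i))    ≡⟨ cong (Z._+_ (Σ< m f))
      (Σ-zero (n ℕ.∸ m) λ i _ → e (m ℕ.+ i) (ℕₚ.m≤m+n m i)) ⟩
    Σ< m f Z.+ 0ℤ                                  ≡⟨ ℤₚ.+-identityʳ _ ⟩
    Σ< m f                                         ∎

  Σ-single : ∀ {n} j f → j < n → (∀ i → i ≢ j → f i ≡ 0ℤ) → Σ< n f ≡ f j
  Σ-single {n} j f j<n e = begin
    Σ< n f       ≡⟨ Σ-extend f j<n (λ i j<i → e i λ { refl → ℕₚ.<-irrefl refl j<i }) ⟩
    Σ< j f Z.+ f j ≡⟨ cong (Z._+ f j) (Σ-zero j λ i i<j → e i λ { refl → ℕₚ.<-irrefl refl i<j }) ⟩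
    0ℤ Z.+ f j   ≡⟨ ℤₚ.+-identityˡ _ ⟩
    f j          ∎

  Σ-multiples : ∀ p .{{_ : NonZero p}} n f → (∀ i → ¬ p ∣ i → f i ≡ 0ℤ) →
    Σ< (n ℕ.* p) f ≡ Σ< n (λ i → f (i ℕ.* p))
  Σ-multiples p zero    f e = refl
  Σ-multiples p@(suc p-1) (suc n) f e = begin
    Σ< (p ℕ.+ n ℕ.* p) f                                  ≡⟨ cong (λ k → Σ< k f)
      (ℕₚ.+-comm p (n ℕ.* p)) ⟩
    Σ< (n ℕ.* p ℕ.+ p) f                                  ≡⟨ Σ-split (n ℕ.* p) p f ⟩
    Σ< (n ℕ.* p) f Z.+ Σ< p (λ i → f (n ℕ.* p ℕ.+ i))     ≡⟨ cong₂ Z._+_ (Σ-multiples p n f e) block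
      ⟩
    Σ< n (λ i → f (i ℕ.* p)) Z.+ f (n ℕ.* p)              ∎
    where
    non-multiple : ∀ i → i ≢ 0 → i < p → ¬ p ∣ n ℕ.* p ℕ.+ i
    non-multiple zero    i≢0 _   _ = i≢0 refl
    non-multiple (suc i) _   i<p d = >⇒∤ i<p (∣m+n∣m⇒∣n d (n∣m*n n))
    block : Σ< p (λ i → f (n ℕ.* p ℕ.+ i)) ≡ f (n ℕ.* p)
    block = begin
      Σ< p (λ i → f (n ℕ.* p ℕ.+ i))                          ≡⟨ Σ-split 1 p-1 _ ⟩
      0ℤ Z.+ f (n ℕ.* p ℕ.+ 0) Z.+ Σ< p-1 (λ i → f (n ℕ.* p ℕ.+ suc i))
        ≡⟨ cong₂ Z._+_ (ℤₚ.+-identityˡ (f (n ℕ.* p ℕ.+ 0)))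
          (Σ-zero p-1 λ i i<p → e _ (non-multiple (suc i) (λ ()) (s≤s i<p))) ⟩
      f (n ℕ.* p ℕ.+ 0) Z.+ 0ℤ                                ≡⟨ ℤₚ.+-identityʳ _ ⟩
      f (n ℕ.* p ℕ.+ 0)                                       ≡⟨ cong f (ℕₚ.+-identityʳ _) ⟩
      f (n ℕ.* p)                                             ∎

  χ : ℕ → ℤ
  χ 0 = 0ℤ
  χ 1 = 1ℤ
  χ 2 = 0ℤ
  χ 3 = -1ℤ
  χ (suc (suc (suc (suc n)))) = χ n

  χ-+2 : ∀ n → χ (2 ℕ.+ n) ≡ Z.- χ n
  χ-+2 0 = refl
  χ-+2 1 = refl
  χ-+2 2 = refl
  χ-+2 3 = refl
  χ-+2 (suc (suc (suc (suc n)))) = χ-+2 n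

  χ-4* : ∀ n m → χ (4 ℕ.* n ℕ.+ m) ≡ χ m
  χ-4* zero    m = refl
  χ-4* (suc n) m = trans (cong χ (trans (cong (ℕ._+ m) (ℕₚ.*-suc 4 n)) (ℕₚ.+-assoc 4 _ m)))
    (χ-4* n m)

  χ-2* : ∀ n → χ (2 ℕ.* n) ≡ 0ℤ
  χ-2* zero    = refl
  χ-2* (suc n) = trans (cong χ (ℕₚ.*-suc 2 n)) (trans (χ-+2 (2 ℕ.* n)) (cong Z.-_ (χ-2* n)))

  χ-3* : ∀ n → χ (3 ℕ.* n) ≡ Z.- χ n
  χ-3* 0 = refl
  χ-3* 1 = refl
  χ-3* 2 = refl
  χ-3* 3 = refl
  χ-3* (suc (suc (suc (suc n)))) = trans (cong χ (ℕₚ.*-distribˡ-+ 3 4 n)) (χ-3* n)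

  χ-* : ∀ m n → χ (m ℕ.* n) ≡ χ m Z.* χ n
  χ-* 0 n = refl
  χ-* 1 n = trans (cong χ (ℕₚ.*-identityˡ n)) (sym (ℤₚ.*-identityˡ (χ n)))
  χ-* 2 n = χ-2* n
  χ-* 3 n = trans (χ-3* n) (sym (ℤₚ.-1*i≡-i (χ n)))
  χ-* (suc (suc (suc (suc m)))) n =
    trans (cong χ (ℕₚ.*-distribʳ-+ n 4 m)) (trans (χ-4* n (m ℕ.* n)) (χ-* m n))

  χ-values : ∀ n → χ n ≡ 0ℤ ⊎ χ n ≡ 1ℤ ⊎ χ n ≡ -1ℤ
  χ-values 0 = inj₁ refl
  χ-values 1 = inj₂ (inj₁ refl)
  χ-values 2 = inj₁ refl
  χ-values 3 = inj₂ (inj₂ refl)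
  χ-values (suc (suc (suc (suc n)))) = χ-values n

  χ-%4 : ∀ n → χ n ≡ χ (n ℕ.% 4)
  χ-%4 0 = refl
  χ-%4 1 = refl
  χ-%4 2 = refl
  χ-%4 3 = refl
  χ-%4 (suc (suc (suc (suc n)))) = χ-%4 n

  χ-factors : ∀ d e → χ (d ℕ.* e) ≡ 1ℤ → χ d ≡ χ e
  χ-factors d e p with χ d | χ e | χ-values d | χ-values e | trans (sym (χ-* d e)) p
  ... | _ | _ | inj₁ refl | _ | ()
  ... | _ | _ | inj₂ (inj₁ refl) | inj₁ refl | ()
  ... | _ | _ | inj₂ (inj₁ refl) | inj₂ (inj₁ refl) | _ = refl
  ... | _ | _ | inj₂ (inj₁ refl) | inj₂ (inj₂ refl) | ()
  ... | _ | _ | inj₂ (inj₂ refl) | inj₁ refl | ()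
  ... | _ | _ | inj₂ (inj₂ refl) | inj₂ (inj₁ refl) | ()
  ... | _ | _ | inj₂ (inj₂ refl) | inj₂ (inj₂ refl) | _ = refl

  -- For b > n > 0, the sum of χ over the divisors of n.
  σ : ℕ → ℕ → ℤ
  σ b n = Σ< b (λ d → χ d Z.* 𝟙[ d ∣? n ])

  -- The k-th Lambert summand starts at exponent k² + k, where 4m + 1 = (2k+1)²; so for n = 4m + 1
  -- it notices d = 2k + 1 only from d² on.
  below-√ : ℕ → ℕ → ℤ
  below-√ n d = χ d Z.* (𝟙[ d ∣? n ] Z.* 𝟙[ d ℕ.* d ℕₚ.<? n ])

  χ[∣]-vanishes : ∀ n .{{_ : NonZero n}} d → n < d → χ d Z.* 𝟙[ d ∣? n ] ≡ 0ℤ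
  χ[∣]-vanishes n d n<d = trans (cong (Z._*_ (χ d)) (𝟙-no (d ∣? n) (>⇒∤ n<d))) (ℤₚ.*-zeroʳ (χ d))

  σ-bound : ∀ n .{{_ : NonZero n}} {b} → n < b → σ b n ≡ σ (suc n) n
  σ-bound n n<b = Σ-extend _ n<b (χ[∣]-vanishes n)

  module _ (n : ℕ) .{{_ : NonZero n}} (χn≡1 : χ n ≡ 1ℤ) (non-square : ∀ c → c ℕ.* c ≢ n) where

    private
      b = suc n

      cofactor-sum : ∀ (u : ℕ → ℤ) d (d∣?n : Dec (d ∣ n)) → d ≢ 0 → ∀ v →
        (∀ e → d ℕ.* e ≡ n → u e ≡ v) →
        Σ< b (λ e → 𝟙[ d ℕ.* e ℕₚ.≟ n ] Z.* u e) ≡ 𝟙[ d∣?n ] Z.* v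
      cofactor-sum u d (no d∤n) d≢0 v _ = Σ-zero b λ e _ → cong (Z._* u e)
        (𝟙-no (d ℕ.* e ℕₚ.≟ n) λ de≡n → d∤n (divides e (trans (sym de≡n) (ℕₚ.*-comm d e))))
      cofactor-sum u d (yes (divides e n≡ed)) d≢0 v u≡v = begin
        Σ< b (λ e → 𝟙[ d ℕ.* e ℕₚ.≟ n ] Z.* u e)
          ≡⟨ Σ-single e _ (s≤s (∣⇒≤ (divides d (sym de≡n)))) others ⟩
        𝟙[ d ℕ.* e ℕₚ.≟ n ] Z.* u e              ≡⟨ cong₂ Z._*_ (𝟙-yes (d ℕ.* e ℕₚ.≟ n) de≡n)
          (u≡v e de≡n) ⟩
        1ℤ Z.* v                                 ∎
        where
        de≡n : d ℕ.* e ≡ n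
        de≡n = trans (ℕₚ.*-comm d e) (sym n≡ed)
        others : ∀ i → i ≢ e → 𝟙[ d ℕ.* i ℕₚ.≟ n ] Z.* u i ≡ 0ℤ
        others i i≢e = cong (Z._* u i) (𝟙-no (d ℕ.* i ℕₚ.≟ n)
          λ di≡n → i≢e (ℕₚ.*-cancelˡ-≡ i e d {{ℕ.≢-nonZero d≢0}} (trans di≡n (sym de≡n))))

      -- Passes from divisors d to factorisations d e = n, where d and e can be exchanged. The case
      -- d = 0, in which e cannot be cancelled for, drops out by χ 0 = 0.
      weighted : ∀ (u : ℕ → ℤ) d v → (d ≢ 0 → ∀ e → d ℕ.* e ≡ n → u e ≡ v) →
        Σ< b (λ e → χ d Z.* (𝟙[ d ℕ.* e ℕₚ.≟ n ] Z.* u e)) ≡ χ d Z.* (𝟙[ d ∣? n ] Z.* v)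
      weighted u zero      v u≡v = Σ-zero b λ _ _ → refl
      weighted u d@(suc _) v u≡v = trans (Σ-* b (χ d) _)
        (cong (Z._*_ (χ d)) (cofactor-sum u d (d ∣? n) (λ ()) v (u≡v λ ())))

      W : ℕ → ℕ → ℤ
      W d e = χ d Z.* (𝟙[ d ℕ.* e ℕₚ.≟ n ] Z.* 𝟙[ d ℕₚ.<? e ])

      ΣW : ∀ d → Σ< b (W d) ≡ below-√ n d
      ΣW d = weighted (λ e → 𝟙[ d ℕₚ.<? e ]) d _ λ { d≢0 e refl → 𝟙-cong (d ℕₚ.<? e)
        (d ℕ.* d ℕₚ.<? d ℕ.* e)
        (λ d<e → ℕₚ.*-monoʳ-< d {{ℕ.≢-nonZero d≢0}} d<e) (ℕₚ.*-cancelˡ-< d d e) }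

      -- χ n = 1 forces χ d = χ e, and n not being a square excludes d = e, so exactly one of the
      -- two terms carries the common value.
      symmetrize : ∀ d e → χ d Z.* (𝟙[ d ℕ.* e ℕₚ.≟ n ] Z.* 1ℤ) ≡ W d e Z.+ W e d
      symmetrize d e with d ℕ.* e ℕₚ.≟ n
      ... | no de≢n = begin
        χ d Z.* 0ℤ                                ≡⟨ ℤₚ.*-zeroʳ (χ d) ⟩
        0ℤ                                        ≡⟨ cong₂ Z._+_ (ℤₚ.*-zeroʳ (χ d))
          (ℤₚ.*-zeroʳ (χ e)) ⟨
        χ d Z.* 0ℤ Z.+ χ e Z.* 0ℤ                 ≡⟨ cong
          (λ i → χ d Z.* 0ℤ Z.+ χ e Z.* (i Z.* 𝟙[ e ℕₚ.<? d ]))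
                                                       (𝟙-no (e ℕ.* d ℕₚ.≟ n)
                                                         (λ p → de≢n (trans (ℕₚ.*-comm d e) p))) ⟨
        χ d Z.* 0ℤ Z.+ W e d                      ∎
      ... | yes de≡n = begin
        χ d Z.* 1ℤ                                ≡⟨ cong (Z._*_ (χ d)) exactly-one ⟨
        χ d Z.* (1ℤ Z.* 𝟙[ d ℕₚ.<? e ] Z.+ 1ℤ Z.* 𝟙[ e ℕₚ.<? d ])
                                                  ≡⟨ ℤₚ.*-distribˡ-+ (χ d) _ _ ⟩
        χ d Z.* (1ℤ Z.* 𝟙[ d ℕₚ.<? e ]) Z.+ χ d Z.* (1ℤ Z.* 𝟙[ e ℕₚ.<? d ])
          ≡⟨ cong₂ (λ c i → χ d Z.* (1ℤ Z.* 𝟙[ d ℕₚ.<? e ]) Z.+ c Z.* (i Z.* 𝟙[ e ℕₚ.<? d ]))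
               (χ-factors d e (trans (cong χ de≡n) χn≡1))
                 (sym (𝟙-yes (e ℕ.* d ℕₚ.≟ n) (trans (ℕₚ.*-comm e d) de≡n))) ⟩
        χ d Z.* (1ℤ Z.* 𝟙[ d ℕₚ.<? e ]) Z.+ W e d ∎
        where
        exactly-one : 1ℤ Z.* 𝟙[ d ℕₚ.<? e ] Z.+ 1ℤ Z.* 𝟙[ e ℕₚ.<? d ] ≡ 1ℤ
        exactly-one with ℕₚ.<-cmp d e
        ... | tri< d<e _ e≮d = cong₂ (λ i j → 1ℤ Z.* i Z.+ 1ℤ Z.* j) (𝟙-yes (d ℕₚ.<? e) d<e)
          (𝟙-no (e ℕₚ.<? d) e≮d)
        ... | tri≈ _ refl _  = contradiction de≡n (non-square d)
        ... | tri> d≮e _ e<d = cong₂ (λ i j → 1ℤ Z.* i Z.+ 1ℤ Z.* j) (𝟙-no (d ℕₚ.<? e) d≮e)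
          (𝟙-yes (e ℕₚ.<? d) e<d)

    σ≡2Σ : σ b n ≡ + 2 Z.* Σ< b (below-√ n)
    σ≡2Σ = begin
      σ b n ≡⟨ Σ-cong b (λ d → trans (cong (Z._*_ (χ d)) (sym (ℤₚ.*-identityʳ 𝟙[ d ∣? n ])))
        (sym (weighted (λ _ → 1ℤ) d 1ℤ (λ _ _ _ → refl)))) ⟩
      Σ< b (λ d → Σ< b (λ e → χ d Z.* (𝟙[ d ℕ.* e ℕₚ.≟ n ] Z.* 1ℤ)))
        ≡⟨ Σ-cong b (λ d → trans (Σ-cong b (symmetrize d)) (Σ-+ b (W d) (λ e → W e d))) ⟩
      Σ< b (λ d → Σ< b (W d) Z.+ Σ< b (λ e → W e d))                 ≡⟨ Σ-+ b _ _ ⟩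
      ΣΣ Z.+ Σ< b (λ d → Σ< b (λ e → W e d))                         ≡⟨ cong (Z._+_ ΣΣ)
        (Σ-swap b b W) ⟨
      ΣΣ Z.+ ΣΣ                                                      ≡⟨ solve 1
        (λ x → x :+ x := con (+ 2) :* x) refl ΣΣ ⟩
      + 2 Z.* ΣΣ                                                     ≡⟨ cong (Z._*_ (+ 2))
        (Σ-cong b ΣW) ⟩
      + 2 Z.* Σ< b (below-√ n)                                       ∎
      where
      open ℤSolver.+-*-Solver
      ΣΣ = Σ< b (λ d → Σ< b (W d))

  -- Divisor sums along the powers of a prime.

  module _ {p : ℕ} (prime : Prime p) where

    private instance
      p≢0 : NonZero p
      p≢0 = prime⇒nonZero prime

    coprime : ∀ {d} → ¬ p ∣ d → Coprime d p
    coprime p∤d (c∣d , c∣p) with prime⇒irreducible prime c∣p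
    ... | inj₁ c≡1  = c≡1
    ... | inj₂ refl = contradiction c∣d p∤d

    drop-powers : ∀ {d} → ¬ p ∣ d → ∀ k {m} → d ∣ p ℕ.^ k ℕ.* m → d ∣ m
    drop-powers {d} p∤d zero    {m} d∣ = subst (d ∣_) (ℕₚ.*-identityˡ m) d∣
    drop-powers {d} p∤d (suc k) {m} d∣ = drop-powers p∤d k {m}
      (coprime-divisor (coprime {d} p∤d) (subst (d ∣_) (ℕₚ.*-assoc p (p ℕ.^ k) m) d∣))

    prime∣square : ∀ c → p ∣ c ℕ.* c → p ∣ c
    prime∣square c p∣c² with euclidsLemma c c prime p∣c²
    ... | inj₁ d = d
    ... | inj₂ d = d

    -- Descent: p divides c, so p² cancels on both sides and the exponent drops by 2. At exponent 1
    -- cancelling p leaves p ∣ m.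
    odd-power-non-square : ∀ {m} → ¬ p ∣ m → ∀ a c → c ℕ.* c ≢ p ℕ.^ (2 ℕ.* a ℕ.+ 1) ℕ.* m
    odd-power-non-square {m} p∤m a c e with prime∣square c (subst (p ∣_)
      (sym (trans e (trans (cong (λ i → p ℕ.^ i ℕ.* m) (ℕₚ.+-comm (2 ℕ.* a) 1))
        (ℕₚ.*-assoc p _ m)))) (m∣m*n _))
    odd-power-non-square {m} p∤m zero _ e | divides c refl = p∤m
      (divides (c ℕ.* c) (sym (ℕₚ.*-cancelˡ-≡ _ _ p (begin
      p ℕ.* (c ℕ.* c ℕ.* p)     ≡⟨ solve 2 (λ c p → p :* (c :* c :* p) := c :* p :* (c :* p)) refl c
        p ⟩
      c ℕ.* p ℕ.* (c ℕ.* p)     ≡⟨ e ⟩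
      p ℕ.* 1 ℕ.* m             ≡⟨ cong (ℕ._* m) (ℕₚ.*-identityʳ p) ⟩
      p ℕ.* m                   ∎))))
      where open ℕSolver.+-*-Solver
    odd-power-non-square {m} p∤m (suc a) _ e | divides c refl = odd-power-non-square p∤m a c
      (ℕₚ.*-cancelˡ-≡ _ _ (p ℕ.* p) {{ℕₚ.m*n≢0 p p}} (begin
      p ℕ.* p ℕ.* (c ℕ.* c)                          ≡⟨ solve 2
        (λ c p → p :* p :* (c :* c) := c :* p :* (c :* p)) refl c p ⟩
      c ℕ.* p ℕ.* (c ℕ.* p)                          ≡⟨ e ⟩
      p ℕ.^ (2 ℕ.* suc a ℕ.+ 1) ℕ.* m                ≡⟨ cong (λ i → p ℕ.^ (i ℕ.+ 1) ℕ.* m)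
        (ℕₚ.*-suc 2 a) ⟩
      p ℕ.* (p ℕ.* p ℕ.^ (2 ℕ.* a ℕ.+ 1)) ℕ.* m      ≡⟨ solve 3
        (λ p y m → p :* (p :* y) :* m := p :* p :* (y :* m)) refl p _ m ⟩
      p ℕ.* p ℕ.* (p ℕ.^ (2 ℕ.* a ℕ.+ 1) ℕ.* m)      ∎))
      where open ℕSolver.+-*-Solver

    module _ (m : ℕ) .{{_ : NonZero m}} (p∤m : ¬ p ∣ m) where

      σₖ : ℕ → ℤ
      σₖ k = σ (suc (p ℕ.^ k ℕ.* m)) (p ℕ.^ k ℕ.* m)

      private
        N : ℕ → ℕ
        N k = p ℕ.^ k ℕ.* m

        N≢0 : ∀ k → NonZero (N k)
        N≢0 k = ℕₚ.m*n≢0 (p ℕ.^ k) m {{ℕₚ.m^n≢0 p k}}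

        -- Divisors prime to p divide m; the others are p times a divisor of p^k m.
        split : ∀ k d → χ d Z.* 𝟙[ d ∣? N (suc k) ] ≡
          χ d Z.* 𝟙[ d ∣? m ] Z.+ 𝟙[ p ∣? d ] Z.* (χ d Z.* 𝟙[ d ∣? N (suc k) ])
        split k d with p ∣? d
        ... | yes p∣d = sym (trans
          (cong₂ Z._+_ (trans (cong (Z._*_ (χ d)) (𝟙-no (d ∣? m) λ d∣m → p∤m (∣-trans p∣d d∣m)))
            (ℤₚ.*-zeroʳ (χ d))) (ℤₚ.*-identityˡ _)) (ℤₚ.+-identityˡ _))
        ... | no  p∤d = trans
          (cong (Z._*_ (χ d)) (𝟙-cong (d ∣? N (suc k)) (d ∣? m) (drop-powers p∤d (suc k) {m})
            (∣n⇒∣m*n (p ℕ.^ suc k))))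
                          (sym (ℤₚ.+-identityʳ _))

      σ-step : ∀ k → σₖ (suc k) ≡ σₖ 0 Z.+ χ p Z.* σₖ k
      σ-step k = begin
        σₖ (suc k)        ≡⟨ σ-bound (N (suc k)) {{N≢0 (suc k)}} N<b ⟨
        σ b (N (suc k))   ≡⟨ Σ-cong b (split k) ⟩
        Σ< b (λ d → χ d Z.* 𝟙[ d ∣? m ] Z.+ 𝟙[ p ∣? d ] Z.* (χ d Z.* 𝟙[ d ∣? N (suc k) ]))
                          ≡⟨ Σ-+ b _ _ ⟩
        σ b m Z.+ Σ< b (λ d → 𝟙[ p ∣? d ] Z.* (χ d Z.* 𝟙[ d ∣? N (suc k) ]))
                          ≡⟨ cong₂ Z._+_ (trans (σ-bound m m<b)
                            (cong (λ i → σ (suc i) i) (sym (ℕₚ.*-identityˡ m)))) multiples ⟩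
        σₖ 0 Z.+ χ p Z.* σₖ k ∎
        where
        -- A common bound for all the sums that is a multiple of p: the multiples of p below it are
        -- e * p for e up to `N k`.
        b = suc (N k) ℕ.* p
        N<b : N (suc k) < b
        N<b = subst (_< b) (trans (ℕₚ.*-comm (N k) p) (sym (ℕₚ.*-assoc p (p ℕ.^ k) m)))
          (ℕₚ.m<n+m (N k ℕ.* p) (ℕ.>-nonZero⁻¹ p))
        m<b : m < b
        m<b = ℕₚ.≤-<-trans (∣⇒≤ {{N≢0 (suc k)}} (n∣m*n (p ℕ.^ suc k))) N<b
        term : ∀ e → 𝟙[ p ∣? e ℕ.* p ] Z.* (χ (e ℕ.* p) Z.* 𝟙[ e ℕ.* p ∣? N (suc k) ])
          ≡ χ p Z.* (χ e Z.* 𝟙[ e ∣? N k ])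
        term e = begin
          𝟙[ p ∣? e ℕ.* p ] Z.* (χ (e ℕ.* p) Z.* 𝟙[ e ℕ.* p ∣? N (suc k) ])
            ≡⟨ cong₂ Z._*_ (𝟙-yes (p ∣? e ℕ.* p) (n∣m*n e))
              (cong₂ Z._*_ (χ-* e p) (𝟙-cong (e ℕ.* p ∣? N (suc k)) (e ∣? N k)
                 (λ d → *-cancelʳ-∣ p (subst (e ℕ.* p ∣_) N-suc d))
                   (λ d → subst (e ℕ.* p ∣_) (sym N-suc) (*-monoˡ-∣ p d)))) ⟩
          1ℤ Z.* (χ e Z.* χ p Z.* 𝟙[ e ∣? N k ])
            ≡⟨ solve 3 (λ x y z → con 1ℤ :* (x :* y :* z) := y :* (x :* z)) refl (χ e)
              (χ p) 𝟙[ e ∣? N k ] ⟩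
          χ p Z.* (χ e Z.* 𝟙[ e ∣? N k ]) ∎
          where
          open ℤSolver.+-*-Solver
          N-suc : N (suc k) ≡ N k ℕ.* p
          N-suc = trans (ℕₚ.*-assoc p (p ℕ.^ k) m) (ℕₚ.*-comm p (N k))
        multiples : Σ< b (λ d → 𝟙[ p ∣? d ] Z.* (χ d Z.* 𝟙[ d ∣? N (suc k) ])) ≡ χ p Z.* σₖ k
        multiples = begin
          Σ< b (λ d → 𝟙[ p ∣? d ] Z.* (χ d Z.* 𝟙[ d ∣? N (suc k) ]))
            ≡⟨ Σ-multiples p (suc (N k)) _ (λ i p∤i → cong (Z._* (χ i Z.* 𝟙[ i ∣? N (suc k) ]))
              (𝟙-no (p ∣? i) p∤i)) ⟩
          Σ< (suc (N k)) (λ e → 𝟙[ p ∣? e ℕ.* p ] Z.* (χ (e ℕ.* p) Z.* 𝟙[ e ℕ.* p ∣? N (suc k) ]))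
            ≡⟨ Σ-cong (suc (N k)) term ⟩
          Σ< (suc (N k)) (λ e → χ p Z.* (χ e Z.* 𝟙[ e ∣? N k ]))
            ≡⟨ Σ-* (suc (N k)) (χ p) _ ⟩
          χ p Z.* σₖ k ∎

      σ-split-prime : χ p ≡ 1ℤ → ∀ k → σₖ k ≡ + suc k Z.* σₖ 0
      σ-split-prime χp≡1 zero    = sym (ℤₚ.*-identityˡ _)
      σ-split-prime χp≡1 (suc k) = begin
        σₖ (suc k)                          ≡⟨ σ-step k ⟩
        σₖ 0 Z.+ χ p Z.* σₖ k               ≡⟨ cong₂ (λ c s → σₖ 0 Z.+ c Z.* s) χp≡1
          (σ-split-prime χp≡1 k) ⟩
        σₖ 0 Z.+ 1ℤ Z.* (+ suc k Z.* σₖ 0)  ≡⟨ solve 2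
          (λ x c → x :+ con 1ℤ :* (c :* x) := (con 1ℤ :+ c) :* x) refl (σₖ 0) (+ suc k) ⟩
        + suc (suc k) Z.* σₖ 0              ∎
        where open ℤSolver.+-*-Solver

      -- Two uses of `σ-step` give σₖ (k + 2) = σₖ 0 - (σₖ 0 - σₖ k) = σₖ k, and σₖ 1 = σₖ 0 - σₖ 0.
      σ-inert-prime : χ p ≡ -1ℤ → ∀ a → σₖ (2 ℕ.* a ℕ.+ 1) ≡ 0ℤ
      σ-inert-prime χp≡-1 zero    = begin
        σₖ 1                        ≡⟨ σ-step 0 ⟩
        σₖ 0 Z.+ χ p Z.* σₖ 0       ≡⟨ cong (λ c → σₖ 0 Z.+ c Z.* σₖ 0) χp≡-1 ⟩
        σₖ 0 Z.+ -1ℤ Z.* σₖ 0       ≡⟨ solve 1 (λ x → x :+ con -1ℤ :* x := con 0ℤ) refl (σₖ 0) ⟩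
        0ℤ                          ∎
        where open ℤSolver.+-*-Solver
      σ-inert-prime χp≡-1 (suc a) = begin
        σₖ (2 ℕ.* suc a ℕ.+ 1)                              ≡⟨ cong (λ i → σₖ (i ℕ.+ 1))
          (ℕₚ.*-suc 2 a) ⟩
        σₖ (suc (suc (2 ℕ.* a ℕ.+ 1)))                      ≡⟨ σ-step (suc (2 ℕ.* a ℕ.+ 1)) ⟩
        σₖ 0 Z.+ χ p Z.* σₖ (suc (2 ℕ.* a ℕ.+ 1))           ≡⟨ cong₂ (λ c s → σₖ 0 Z.+ c Z.* s)
          χp≡-1 (trans (σ-step (2 ℕ.* a ℕ.+ 1))
                                                                 (cong₂ (λ c s → σₖ 0 Z.+ c Z.* s)
                                                                   χp≡-1 (σ-inert-prime χp≡-1 a))) ⟩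
        σₖ 0 Z.+ -1ℤ Z.* (σₖ 0 Z.+ -1ℤ Z.* 0ℤ)              ≡⟨ solve 1
          (λ x → x :+ con -1ℤ :* (x :+ con -1ℤ :* con 0ℤ) := con 0ℤ) refl (σₖ 0) ⟩
        0ℤ                                                  ∎
        where open ℤSolver.+-*-Solver

-- Coefficients of the Lambert series, and the two progressions.

module Conclusion where

  open import Defs using (ped₋₂)
  import Data.Integer.Divisibility.Signed as Z∣
  open import Data.Nat.DivMod using (m≡m%n+[m/n]*n; %-distribˡ-*; m*n/n≡m)
  open import Data.Nat.GCD using (gcd; gcd-greatest)
  open import Data.Nat.Primality using (Prime; prime⇒nonTrivial)
  open FormalSeries
  open Congruence
  open Theta
  open GeneratingFunction
  open PartitionCount
  open DivisorCharacterSum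

  module ℕ-Ring = ℕSolver.+-*-Solver

  X^-at : ∀ e c m → m ≢ e → (const c * X ^ e) m ≡ 0ℤ
  X^-at e c m m≢e = ≡.trans (at (*-comm (const c) (X ^ e)) m)
    (low-or-shifted e (λ k → k ≢ e → (X ^ e * const c) k ≡ 0ℤ)
    (λ k k<e _ → X^*-< e (const c) k<e)
    (λ { zero e+0≢e → contradiction (ℕₚ.+-identityʳ e) e+0≢e ; (suc k) _ → X^*-+ e (const c)
      (suc k) }) m m≢e)

  module _ (m : ℕ) (non-square : ∀ c → c ℕ.* c ≢ 4 ℕ.* m ℕ.+ 1) where

    private
      N = 4 ℕ.* m ℕ.+ 1

      N≢0 : NonZero N
      N≢0 = ≡.subst NonZero (ℕₚ.+-comm 1 (4 ℕ.* m)) _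

    -- The exponents of `E` are m = 2T with T triangular, and then 4m + 1 = 8T + 1 is a square:
    -- (4n+1)² for `T₁ n` and (4n+3)² for `T₂ n`.
    E-vanishes : ∀ n → E n m ≡ 0ℤ
    E-vanishes zero    = 0-at m
    E-vanishes (suc n) = ≡.trans (+-at _ _ m)
      (cong₂ Z._+_ (E-vanishes n) (≡.trans (+-at _ _ m) (cong₂ Z._+_
      (X^-at (T₁ n ℕ.+ T₁ n) (ε (T₁ n) Z.* ε (T₁ n)) m λ { ≡.refl → non-square (4 ℕ.* n ℕ.+ 1)
        (solve 1 (λ n → (con 4 :* n :+ con 1) :* (con 4 :* n :+ con 1) :=
           con 4 :* (n :* (con 1 :+ (n :+ n)) :+ n :* (con 1 :+ (n :+ n))) :+ con 1) ≡.refl n) })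
      (X^-at (T₂ n ℕ.+ T₂ n) (ε (T₂ n) Z.* ε (T₂ n)) m λ { ≡.refl → non-square (4 ℕ.* n ℕ.+ 3)
        (solve 1 (λ n → (con 4 :* n :+ con 3) :* (con 4 :* n :+ con 3) :=
           con 4 :* ((con 1 :+ n) :* (con 1 :+ (n :+ n)) :+ (con 1 :+ n) :* (con 1 :+ (n :+ n))) :+
             con 1) ≡.refl n) }))))
      where open ℕ-Ring

    private
      Λ-term : ℕ → Series
      Λ-term k = G⁺.t k * (1# + X * G⁺.Q ^ k) * G⁺.o k

      d : ℕ → ℕ
      d k = suc (k ℕ.+ k)

      -- The sign (-1)^k is χ (2k + 1), which is how the character enters.
      t≈ : ∀ k → G⁺.t k ≈ const (χ (d k)) * X ^ (k ℕ.* suc k)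
      t≈ zero    = sym (*-identityˡ _)
      t≈ (suc k) =
        (linear (- y) (t≈ k)
        (linear (- (c0 * x0)) (G⁺.Q^≈^ k)
        (linear (- x1) c1≈
        (linear c0 x1≈
        (solve 7 (λ c0 c1 t0 x0 x1 y z →
            (:- (t0 :* y))
            :+ (:- y) :* (c0 :* x0)
            :+ (:- (c0 :* x0)) :* z
            :+ (:- x1) :* (:- c0)
            :+ c0 :* (x0 :* z)
          := c1 :* x1
            :+ (:- y) :* t0
            :+ (:- (c0 :* x0)) :* y
            :+ (:- x1) :* c1
            :+ c0 :* x1)
          refl c0 c1 t0 x0 x1 y z)))))
        where
        open Solver
        t0 = G⁺.t k
        y = G⁺.Q ^ suc k
        z = X ^ suc (suc (k ℕ.+ k))
        c0 = const (χ (d k))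
        c1 = const (χ (d (suc k)))
        x0 = X ^ (k ℕ.* suc k)
        x1 = X ^ (suc k ℕ.* suc (suc k))
        c1≈ : c1 ≈ - c0
        c1≈ = trans (reflexive
          (cong const (≡.trans (cong (λ j → χ (suc (suc j))) (ℕₚ.+-suc k k)) (χ-+2 (d k)))))
            (const-neg (χ (d k)))
        x1≈ : x1 ≈ x0 * z
        x1≈ = trans (reflexive
          (cong (X ^_) (ℕ-Ring.solve 1
            (λ k → (con′ 1 :+′ k) :*′ (con′ 2 :+′ k) :=′ k :*′ (con′ 1 :+′ k) :+′
              (con′ 2 :+′ (k :+′ k))) ≡.refl k)))
          (^-+ X (k ℕ.* suc k) (suc (suc (k ℕ.+ k))))
          where open ℕ-Ring renaming (con to con′; _:+_ to _:+′_; _:*_ to _:*′_; _:=_ to _:=′_)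

      -- (1 + y)/(1 - y) = 2/(1 - y) - 1 with y = X^(2k+1). The -1 is felt only at the exponent k² +
      -- k, where 4m + 1 is a square.
      Λ-term≈ : ∀ k → Λ-term k
        ≈ X ^ (k ℕ.* suc k) * (const (χ (d k)) * (const (+ 2) * geom (k ℕ.+ k) + - 1#))
      Λ-term≈ k =
        (linear ((1# + X0 * y) * g) (t≈ k)
        (linear (- (c0 * x0 * g)) (G⁺.odd≈ k)
        (linear (- (c0 * x0)) (G⁺.o-inverse k)
        (solve 7 (λ X0 c0 g od t0 x0 y →
            t0 :* (one :+ X0 :* y) :* g
            :+ (one :+ X0 :* y) :* g :* (c0 :* x0)
            :+ (:- (c0 :* x0 :* g)) :* (X0 :* y)
            :+ (:- (c0 :* x0)) :* one
          := x0 :* (c0 :* (con (+ 2) :* g :- one))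
            :+ (one :+ X0 :* y) :* g :* t0
            :+ (:- (c0 :* x0 :* g)) :* od
            :+ (:- (c0 :* x0)) :* (g :* (one :- od)))
          refl X0 c0 g od t0 x0 y))))
        where
        open Solver
        t0 = G⁺.t k
        X0 = X
        y = G⁺.Q ^ k
        g = geom (k ℕ.+ k)
        od = G⁺.odd k
        x0 = X ^ (k ℕ.* suc k)
        c0 = const (χ (d k))

      square-d : ∀ k → d k ℕ.* d k ≡ 4 ℕ.* (k ℕ.* suc k) ℕ.+ 1
      square-d = solve 1 (λ k → (con 1 :+ (k :+ k)) :* (con 1 :+ (k :+ k)) := con
        4 :* (k :* (con 1 :+ k)) :+ con 1) ≡.refl
        where open ℕ-Ring

      d∣j⇒d∣N : ∀ k j → d k ∣ j → d k ∣ 4 ℕ.* (k ℕ.* suc k ℕ.+ j) ℕ.+ 1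
      d∣j⇒d∣N k j d∣j = ≡.subst (d k ∣_)
        (≡.trans (cong (ℕ._+ 4 ℕ.* j) (square-d k))
          (solve 2 (λ e j → con 4 :* e :+ con 1 :+ con 4 :* j := con 4 :* (e :+ j) :+ con 1) ≡.refl
            (k ℕ.* suc k) j))
        (∣m∣n⇒∣m+n (m∣m*n (d k)) (∣n⇒∣m*n 4 d∣j))
        where open ℕ-Ring

      -- d² = (2k+1)² = 4k(k+1) + 1, so d is prime to 4 and d ∣ 4j gives d ∣ j.
      d∣N⇒d∣j : ∀ k j → d k ∣ 4 ℕ.* (k ℕ.* suc k ℕ.+ j) ℕ.+ 1 → d k ∣ j
      d∣N⇒d∣j k j d∣N = ∣m+n∣m⇒∣n (≡.subst (d k ∣_)
          (≡.trans (cong (ℕ._* j) (square-d k))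
            (solve 2 (λ e j → (con 4 :* e :+ con 1) :* j := e :* (con 4 :* j) :+ j) ≡.refl
              (k ℕ.* suc k) j))
          (∣m⇒∣m*n j (m∣m*n (d k))))
        (∣n⇒∣m*n (k ℕ.* suc k) d∣4j)
        where
        open ℕ-Ring
        d∣4j : d k ∣ 4 ℕ.* j
        d∣4j = ∣m+n∣m⇒∣n (≡.subst (d k ∣_)
          (≡.sym (≡.trans (cong (ℕ._+ 4 ℕ.* j) (square-d k))
            (solve 2 (λ e j → con 4 :* e :+ con 1 :+ con 4 :* j := con 4 :* (e :+ j) :+ con 1)
              ≡.refl (k ℕ.* suc k) j))) d∣N)
          (m∣m*n (d k))

      -- Being a non-square is part of the predicate because `low-or-shifted` varies the exponent.
      Λ-Coefficient : ℕ → ℕ → Set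
      Λ-Coefficient k m′ = (∀ c → c ℕ.* c ≢ 4 ℕ.* m′ ℕ.+ 1) →
        (X ^ (k ℕ.* suc k) * (const (χ (d k)) * (const (+ 2) * geom (k ℕ.+ k) + - 1#))) m′
          ≡ + 2 Z.* below-√ (4 ℕ.* m′ ℕ.+ 1) (d k)

      -- At exponent k(k+1) + j one has 4m′ + 1 = d² + 4j with d = 2k + 1. Hence d divides 4m′ + 1
      -- exactly when it divides j, and d² < 4m′ + 1 exactly when j > 0; j = 0 would give a square.
      Λ-coefficient : ∀ k m′ → Λ-Coefficient k m′
      Λ-coefficient k = low-or-shifted e (Λ-Coefficient k) low high
        where
        e = k ℕ.* suc k
        low : ∀ m′ → m′ < e → Λ-Coefficient k m′
        low m′ m′<e _ = ≡.trans (X^*-< e _ m′<e)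
          (≡.sym (cong (Z._*_ (+ 2)) (≡.trans (cong (Z._*_ (χ (d k)))
          (≡.trans (cong (Z._*_ 𝟙[ d k ∣? 4 ℕ.* m′ ℕ.+ 1 ]) (𝟙-no (d k ℕ.* d k ℕₚ.<? 4 ℕ.* m′ ℕ.+ 1)
             λ d²<N → ℕₚ.<-asym (ℕₚ.+-monoˡ-< 1 (ℕₚ.*-monoʳ-< 4 m′<e))
               (≡.subst (_< 4 ℕ.* m′ ℕ.+ 1) (square-d k) d²<N)))
                 (ℤₚ.*-zeroʳ 𝟙[ d k ∣? 4 ℕ.* m′ ℕ.+ 1 ])))
          (ℤₚ.*-zeroʳ (χ (d k))))))
        high : ∀ j → Λ-Coefficient k (e ℕ.+ j)
        high zero    non-sq = contradiction
          (≡.trans (square-d k) (cong (λ i → 4 ℕ.* i ℕ.+ 1) (≡.sym (ℕₚ.+-identityʳ e))))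
            (non-sq (d k))
        high (suc j) non-sq = ≡.trans (X^*-+ e _ (suc j)) (≡.trans (const*-at (χ (d k)) _ (suc j))
          (≡.trans
          (cong (Z._*_ (χ (d k)))
            (≡.trans (+-at _ _ (suc j)) (cong₂ Z._+_ (const*-at (+ 2) _ (suc j))
              (-‿at 1# (suc j)))))
          (≡.trans (ℤRing.solve 2 (λ c g → c :*′ (con′ (+ 2) :*′ g :+′ con′ 0ℤ) :=′ con′
            (+ 2) :*′ (c :*′ (g :*′ con′ 1ℤ))) ≡.refl (χ (d k)) (geom (k ℕ.+ k) (suc j)))
            (cong₂ (λ a b → + 2 Z.* (χ (d k) Z.* (a Z.* b)))
              (𝟙-cong (d k ∣? suc j) (d k ∣? 4 ℕ.* (e ℕ.+ suc j) ℕ.+ 1) (d∣j⇒d∣N k (suc j))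
                (d∣N⇒d∣j k (suc j)))
              (≡.sym (𝟙-yes (d k ℕ.* d k ℕₚ.<? 4 ℕ.* (e ℕ.+ suc j) ℕ.+ 1) d²<N))))))
          where
          module ℤRing = ℤSolver.+-*-Solver
          open ℤRing renaming (con to con′; _:+_ to _:+′_; _:*_ to _:*′_; _:=_ to _:=′_)
          d²<N : d k ℕ.* d k < 4 ℕ.* (e ℕ.+ suc j) ℕ.+ 1
          d²<N = ≡.subst (_< 4 ℕ.* (e ℕ.+ suc j) ℕ.+ 1) (≡.sym (square-d k))
            (ℕₚ.+-monoˡ-< 1 (ℕₚ.*-monoʳ-< 4 (ℕₚ.m<m+n e (s≤s z≤n))))

      -- The series meets only the odd d < 2n; the even ones can be included because χ vanishes
      -- there.
      Λ≡ : ∀ n → G⁺.Λ n m ≡ + 2 Z.* Σ< (n ℕ.+ n) (below-√ N)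
      Λ≡ zero    = 0-at m
      Λ≡ (suc n) = ≡.trans (+-at _ _ m)
        (≡.trans (cong₂ Z._+_ (Λ≡ n) (≡.trans (at (Λ-term≈ n) m) (Λ-coefficient n m non-square)))
        (≡.trans (ℤRing.solve 2 (λ s g → con′ (+ 2) :*′ s :+′ con′ (+ 2) :*′ g :=′ con′
          (+ 2) :*′ (s :+′ con′ 0ℤ :+′ g)) ≡.refl (Σ< (n ℕ.+ n) (below-√ N)) (below-√ N (d n)))
          (≡.trans (cong (λ z → + 2 Z.* (Σ< (n ℕ.+ n) (below-√ N) Z.+ z Z.+ below-√ N (d n)))
            (≡.sym even-vanishes))
            (cong (λ i → + 2 Z.* Σ< (suc i) (below-√ N)) (≡.sym (ℕₚ.+-suc n n))))))
        where
        module ℤRing = ℤSolver.+-*-Solver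
        open ℤRing renaming (con to con′; _:+_ to _:+′_; _:*_ to _:*′_; _:=_ to _:=′_)
        even-vanishes : below-√ N (n ℕ.+ n) ≡ 0ℤ
        even-vanishes = cong (Z._* (𝟙[ n ℕ.+ n ∣? N ] Z.* 𝟙[ (n ℕ.+ n) ℕ.* (n ℕ.+ n) ℕₚ.<? N ]))
          (≡.trans (cong (λ i → χ (n ℕ.+ i)) (≡.sym (ℕₚ.+-identityʳ n))) (χ-2* n))

      -- (2m + 2)² ≥ 4m + 1, so m + 1 summands already reach every d with d² < N; `σ≡2Σ` then
      -- restores the divisors above the root.
      Λ≡σ : G⁺.Λ (suc m) m ≡ σ (suc N) N
      Λ≡σ = ≡.trans (Λ≡ (suc m))
        (≡.trans (cong (Z._*_ (+ 2)) (≡.sym (Σ-extend (below-√ N) short large)))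
        (≡.sym (σ≡2Σ N {{N≢0}} (χ-4* m 1) non-square)))
        where
        open ℕ-Ring
        short : suc m ℕ.+ suc m ≤ suc N
        short = ≡.subst (_≤ suc N)
          (solve 1 (λ m → con 2 :* m :+ con 2 := con 1 :+ m :+ (con 1 :+ m)) ≡.refl m)
          (≡.subst (2 ℕ.* m ℕ.+ 2 ≤_)
            (solve 1 (λ m → con 4 :* m :+ con 2 := con 1 :+ (con 4 :* m :+ con 1)) ≡.refl m)
            (ℕₚ.+-monoˡ-≤ 2 (ℕₚ.*-monoˡ-≤ m {2} {4} (s≤s (s≤s z≤n)))))
        large : ∀ i → suc m ℕ.+ suc m ≤ i → below-√ N i ≡ 0ℤ
        large i b≤i = ≡.trans
          (cong (Z._*_ (χ i)) (≡.trans (cong (Z._*_ 𝟙[ i ∣? N ]) (𝟙-no (i ℕ.* i ℕₚ.<? N)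
            λ i²<N → ℕₚ.<-irrefl ≡.refl
              (ℕₚ.<-≤-trans i²<N (ℕₚ.≤-trans N≤b² (ℕₚ.*-mono-≤ b≤i b≤i)))))
                (ℤₚ.*-zeroʳ 𝟙[ i ∣? N ]))) (ℤₚ.*-zeroʳ (χ i))
          where
          N≤b² : N ≤ (suc m ℕ.+ suc m) ℕ.* (suc m ℕ.+ suc m)
          N≤b² = ≡.subst (N ≤_)
            (solve 1 (λ m → con 4 :* m :+ con 1 :+ (con 4 :* m :* m :+ con 4 :* m :+ con 3)
              := (con 1 :+ m :+ (con 1 :+ m)) :* (con 1 :+ m :+ (con 1 :+ m))) ≡.refl m)
            (ℕₚ.m≤m+n N _)

    ped₋₂-mod-8 : ∃ λ s → + ped₋₂ m ≡ σ (suc N) N Z.+ + 8 Z.* s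
    ped₋₂-mod-8 = proj₁ e , ≡.trans (ped₋₂≡ (suc m) m ℕₚ.≤-refl)
      (≡.trans (proj₂ e) (cong (Z._+ (+ 8 Z.* proj₁ e))
      (≡.trans (+-at _ _ m)
        (≡.trans (cong₂ Z._+_ Λ≡σ (≡.trans (const*-at (+ 4) (E (suc m)) m)
          (cong (Z._*_ (+ 4)) (E-vanishes (suc m))))) (ℤₚ.+-identityʳ (σ (suc N) N))))))
      where e = mod-coefficient (ped²≡Λ+4E m) ℕₚ.≤-refl

    8∣ped₋₂ : (∃ λ c → σ (suc N) N ≡ + 8 Z.* c) → 8 ∣ ped₋₂ m
    8∣ped₋₂ (c , σ≡8c) = Z∣.∣⇒∣ᵤ {+ 8} {+ ped₋₂ m} (Z∣.divides (c Z.+ proj₁ ped₋₂-mod-8)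
      (≡.trans (proj₂ ped₋₂-mod-8)
      (≡.trans (cong (Z._+ (+ 8 Z.* proj₁ ped₋₂-mod-8)) σ≡8c)
        (solve 2 (λ c s → con (+ 8) :* c :+ con (+ 8) :* s := (c :+ s) :* con (+ 8)) ≡.refl c
          (proj₁ ped₋₂-mod-8)))))
      where open ℤSolver.+-*-Solver

  odd-power%4 : ∀ r p → (r ℕ.* p) ℕ.% 4 ≡ 1 → (p ℕ.* p) ℕ.% 4 ≡ 1 → ∀ a →
    (r ℕ.* p ℕ.^ (2 ℕ.* a ℕ.+ 1)) ℕ.% 4 ≡ 1
  odd-power%4 r p e e² zero    = ≡.trans (cong (λ i → (r ℕ.* i) ℕ.% 4) (ℕₚ.*-identityʳ p)) e
  odd-power%4 r p e e² (suc a) = ≡.trans (cong (ℕ._% 4)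
      (≡.trans (cong (λ i → r ℕ.* p ℕ.^ (i ℕ.+ 1)) (ℕₚ.*-suc 2 a))
        (solve 3 (λ r p y → r :* (p :* (p :* y)) := p :* p :* (r :* y)) ≡.refl r p
          (p ℕ.^ (2 ℕ.* a ℕ.+ 1)))))
    (≡.trans (%-distribˡ-* (p ℕ.* p) (r ℕ.* p ℕ.^ (2 ℕ.* a ℕ.+ 1)) 4)
      (cong₂ (λ i j → (i ℕ.* j) ℕ.% 4) e² (odd-power%4 r p e e² a)))
    where open ℕ-Ring

  -- The residue 1 makes both the truncated subtraction and the floor division exact.
  4*[pred/4]+1 : ∀ n → n ℕ.% 4 ≡ 1 → 4 ℕ.* ((n ℕ.∸ 1) ℕ./ 4) ℕ.+ 1 ≡ n
  4*[pred/4]+1 n e = ≡.trans (cong (λ i → 4 ℕ.* ((i ℕ.∸ 1) ℕ./ 4) ℕ.+ 1) n≡)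
    (≡.trans (cong (λ i → 4 ℕ.* i ℕ.+ 1) (m*n/n≡m (n ℕ./ 4) 4))
    (≡.trans (ℕₚ.+-comm _ 1) (≡.trans (cong suc (ℕₚ.*-comm 4 (n ℕ./ 4))) (≡.sym n≡))))
    where
    n≡ : n ≡ suc (n ℕ./ 4 ℕ.* 4)
    n≡ = ≡.trans (m≡m%n+[m/n]*n n 4) (cong (ℕ._+ n ℕ./ 4 ℕ.* 4) e)

  module Progression (p : ℕ) (prime : Prime p) (p²%4 : (p ℕ.* p) ℕ.% 4 ≡ 1)
    (r : ℕ) (gcd≡1 : gcd r p ≡ 1) (rp%4 : (r ℕ.* p) ℕ.% 4 ≡ 1) (n : ℕ) where

    -- What is left of 4 · `index a` + 1 once p^(2a+1) is split off; it does not depend on a.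
    cofactor : ℕ
    cofactor = 4 ℕ.* p ℕ.* n ℕ.+ r

    index : ℕ → ℕ
    index a = p ℕ.^ (2 ℕ.* a ℕ.+ 2) ℕ.* n ℕ.+ (r ℕ.* p ℕ.^ (2 ℕ.* a ℕ.+ 1) ℕ.∸ 1) ℕ./ 4

    4*index+1 : ∀ a → 4 ℕ.* index a ℕ.+ 1 ≡ p ℕ.^ (2 ℕ.* a ℕ.+ 1) ℕ.* cofactor
    4*index+1 a = ≡.trans (cong (λ i → 4 ℕ.* (i ℕ.* n ℕ.+ t) ℕ.+ 1)
      (cong (p ℕ.^_) (ℕₚ.+-suc (2 ℕ.* a) 1)))
      (≡.trans (solve 4 (λ p y n t → con 4 :* (p :* y :* n :+ t) :+ con 1 := con 4 :* p :* y :* n :+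
        (con 4 :* t :+ con 1)) ≡.refl p y n t)
      (≡.trans (cong (4 ℕ.* p ℕ.* y ℕ.* n ℕ.+_)
        (4*[pred/4]+1 (r ℕ.* y) (odd-power%4 r p rp%4 p²%4 a)))
        (solve 4 (λ p y n r → con 4 :* p :* y :* n :+ r :* y := y :* (con 4 :* p :* n :+ r)) ≡.refl
          p y n r)))
      where
      open ℕ-Ring
      y = p ℕ.^ (2 ℕ.* a ℕ.+ 1)
      t = (r ℕ.* y ℕ.∸ 1) ℕ./ 4

    p∤cofactor : ¬ p ∣ cofactor
    p∤cofactor d = ℕ.nonTrivial⇒≢1 {{prime⇒nonTrivial prime}} (∣1⇒≡1 (≡.subst (p ∣_) gcd≡1
      (gcd-greatest (∣m+n∣m⇒∣n d (∣m⇒∣m*n n (n∣m*n 4))) ∣-refl)))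

    instance
      cofactor≢0 : NonZero cofactor
      cofactor≢0 = ℕ.≢-nonZero λ e → p∤cofactor (≡.subst (p ∣_) (≡.sym e) (p ∣0))

    -- The exponent 2a + 1 is odd and p does not divide the cofactor, so 4 · `index a` + 1 is not a
    -- square and the formula modulo 8 applies.
    conclude : ∀ a → (∃ λ c → σₖ prime cofactor p∤cofactor (2 ℕ.* a ℕ.+ 1) ≡ + 8 Z.* c) →
      8 ∣ ped₋₂ (index a)
    conclude a (c , e) = 8∣ped₋₂ (index a) (λ c e → odd-power-non-square prime p∤cofactor a c
      (≡.trans e (4*index+1 a)))
      (c , ≡.trans (cong (λ N → σ (suc N) N) (4*index+1 a)) e)

  χ-residue : ∀ p {i} → p ℕ.% 4 ≡ i → χ p ≡ χ i
  χ-residue p e = ≡.trans (χ-%4 p) (cong χ e)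

  square%4 : ∀ p {i} → p ℕ.% 4 ≡ i → (p ℕ.* p) ℕ.% 4 ≡ (i ℕ.* i) ℕ.% 4
  square%4 p e = ≡.trans (%-distribˡ-* p p 4) (cong₂ (λ i j → (i ℕ.* j) ℕ.% 4) e e)

  inert : ∀ p → Prime p → p ℕ.% 4 ≡ 3 →
    ∀ r → 1 ≤ r → r < 4 ℕ.* p → gcd r p ≡ 1 → (r ℕ.* p) ℕ.% 4 ≡ 1 → ∀ α n →
    8 ∣ ped₋₂ (p ℕ.^ (2 ℕ.* α ℕ.+ 2) ℕ.* n ℕ.+ (r ℕ.* p ℕ.^ (2 ℕ.* α ℕ.+ 1) ℕ.∸ 1) ℕ./ 4)
  inert p p-prime p%4 r _ _ gcd≡1 rp%4 α n = conclude α
    (0ℤ , σ-inert-prime p-prime cofactor p∤cofactor (χ-residue p p%4) α)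
    where open Progression p p-prime (square%4 p p%4) r gcd≡1 rp%4 n

  split : ∀ p → Prime p → p ℕ.% 4 ≡ 1 →
    ∀ r → 1 ≤ r → r < 4 ℕ.* p → gcd r p ≡ 1 → (r ℕ.* p) ℕ.% 4 ≡ 1 → ∀ α n →
    8 ∣ ped₋₂ (p ℕ.^ (8 ℕ.* α ℕ.+ 8) ℕ.* n ℕ.+ (r ℕ.* p ℕ.^ (8 ℕ.* α ℕ.+ 7) ℕ.∸ 1) ℕ./ 4)
  split p p-prime p%4 r _ _ gcd≡1 rp%4 α n = ≡.subst₂
    (λ i j → 8 ∣ ped₋₂ (p ℕ.^ i ℕ.* n ℕ.+ (r ℕ.* p ℕ.^ j ℕ.∸ 1) ℕ./ 4))
    (solve 1 (λ α → con 2 :* (con 4 :* α :+ con 3) :+ con 2 := con 8 :* α :+ con 8) ≡.refl α)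
    (solve 1 (λ α → con 2 :* (con 4 :* α :+ con 3) :+ con 1 := con 8 :* α :+ con 7) ≡.refl α)
    (conclude a (+ suc α Z.* τ , ≡.trans (σ-split-prime p-prime cofactor p∤cofactor
      (χ-residue p p%4) (2 ℕ.* a ℕ.+ 1))
      (≡.trans (cong (λ k → + k Z.* τ)
        (solve 1 (λ α → con 1 :+ (con 2 :* (con 4 :* α :+ con 3) :+ con 1) := con 8 :* (con 1 :+ α))
          ≡.refl α))
        (≡.trans (cong (Z._* τ) (ℤₚ.pos-* 8 (suc α))) (ℤₚ.*-assoc (+ 8) (+ suc α) τ)))))
    where
    open Progression p p-prime (square%4 p p%4) r gcd≡1 rp%4 n
    open ℕ-Ring
    -- Then 2a + 1 = 8α + 7, and the factor (2a + 1) + 1 from `σ-split-prime` is 8 (α + 1).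
    a = 4 ℕ.* α ℕ.+ 3
    τ = σₖ p-prime cofactor p∤cofactor 0

open import Defs using (ped₋₂)
open import Data.Nat.Base using (ℕ; _+_; _*_; _∸_; _^_; _/_; _%_; _≤_; _<_)
open import Data.Nat.Divisibility using (_∣_)
open import Data.Nat.GCD using (gcd)
open import Data.Nat.Primality using (Prime)
open import Data.Product.Base using (_×_)
open import Relation.Binary.PropositionalEquality using (_≡_)

corollary1p7 : (∀ (p : ℕ) → Prime p → p % 4 ≡ 3 →
    ∀ (r : ℕ) → 1 ≤ r → r < 4 * p → gcd r p ≡ 1 → (r * p) % 4 ≡ 1 →
    ∀ (α n : ℕ) →
    8 ∣ ped₋₂ (p ^ (2 * α + 2) * n + (r * p ^ (2 * α + 1) ∸ 1) / 4))
    ×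
    (∀ (p : ℕ) → Prime p → p % 4 ≡ 1 →
    ∀ (r : ℕ) → 1 ≤ r → r < 4 * p → gcd r p ≡ 1 → (r * p) % 4 ≡ 1 →
    ∀ (α n : ℕ) →
    8 ∣ ped₋₂ (p ^ (8 * α + 8) * n + (r * p ^ (8 * α + 7) ∸ 1) / 4))
corollary1p7 = Conclusion.inert , Conclusion.split
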